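{- The $p$-facility upgrading maximal covering location problem, $p$-Up-MCLP, restricted to instances whose network is a star and whose node weights are uniform (there is $w\in\mathbb{R}^+$ with $w_i=w$ for all $i\in V$), can be solved in $O(n\log n)$ time, where $n$ is the number of nodes. That is, there is an algorithm which, given any such instance, computes an optimal solution $(X_p,\delta)$ in $O(n\log n)$ time.
   Context: Problem $p$-Up-MCLP. An instance consists of: an undirected network $N=(V,E,\ell)$ with finite node set $V$, $|V|=n$, edge set $E$ and positive edge lengths $\ell_e$, $e\in E$; non-negative node weights $w_i$, $i\in V$; a coverage radius $R>0$; upgrading bounds $u_e\in[0,\ell_e)$, $e\in E$; upgrading costs per unit $c_e\in\mathbb{R}^+$, $e\in E$; a budget $B\in\mathbb{R}^+$; and a number $p\in\mathbb{N}$ of facilities, $p\le|V|$. For a vector of reductions $\delta=(\delta_e)_{e\in E}$ with $0\le\delta_e\le u_e$, $d(i,j,\delta)$ is the length of a shortest path between $i$ and $j$ in the network where each edge $e$ has length $\ell_e-\delta_e$. For $X\subseteq V$ let $C(X,\delta)=\{i\in V \mid \exists j\in X:\ d(i,j,\delta)\le R\}$ be the set of covered nodes. A feasible solution is a pair $(X_p,\delta)$ with $X_p\subseteq V$, $|X_p|=p$, $0\le\delta_e\le u_e$ for all $e\in E$, and $\sum_{e\in E}c_e\delta_e\le B$; the objective is to maximise $\sum_{i\in C(X_p,\delta)}w_i$. A star network is a network with a central node $v_0$ whose edges are exactly those joining $v_0$ to each of the other (satellite) nodes. Costs $c_e$, bounds $u_e$ and lengths $\ell_e$ may be arbitrary (non-uniform);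 $p$ is part of the input. Running time counts elementary arithmetic operations and comparisons on the input numbers, each at unit cost. -}

module Defs where

open import Level using (0ℓ)
open import Algebra.Bundles using (CommutativeRing)
import Algebra.Definitions.RawMonoid as RawMonoidDefinitions
open import Data.Bool.Base using (Bool; true; false; if_then_else_)
open import Data.Fin.Base using (Fin; toℕ)
open import Data.Fin.Subset as Subset using (Subset; ∣_∣)
open import Data.Fin.Subset.Properties using (_∈?_)
open import Data.List.Base as List using (List; []; _∷_; allFin; filter; foldl)
open import Data.List.Membership.Propositional using (_∈_)
open import Data.List.Relation.Binary.Permutation.Propositional using (_↭_)
open import Data.List.Relation.Unary.All as All using (All; []; _∷_)
open import Data.List.Relation.Unary.Unique.Propositional using (Unique)
open import Data.Nat.Base as ℕ using (ℕ; zero; suc)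
open import Data.Nat.GeneralisedArithmetic using (iterate)
open import Data.Product.Base using (Σ; ∃; ∃-syntax; _×_; _,_; proj₁; proj₂)
open import Data.Sum.Base using (_⊎_)
open import Data.Vec.Base using (lookup)
open import Function.Bundles using (_⇔_)
open import Relation.Binary.Core using (Rel)
open import Relation.Binary.PropositionalEquality.Core using (_≡_; _≢_)
import Relation.Binary.Construct.NonStrictToStrict as NonStrictToStrict
open import Relation.Binary.Structures using (IsDecTotalOrder)
open import Relation.Nullary using (¬_; yes; no; ⌊_⌋)

------------------------------------------------------------------------
-- Ordered fields

-- The real numbers enter only through their ordered field structure, so
-- everything is stated over an arbitrary ordered field.  The order is
-- decidable because comparing two numbers is an elementary operation of
-- the machine.

record OrderedField : Set₁ where
  infix 4 _≤_
  field
    commutativeRing : CommutativeRing 0ℓ 0ℓ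

  open CommutativeRing commutativeRing public renaming (zero to *-zero)

  field
    _≤_             : Rel Carrier 0ℓ
    isDecTotalOrder : IsDecTotalOrder _≈_ _≤_
    0≉1             : ¬ (0# ≈ 1#)
    inverse         : ∀ x → ¬ (x ≈ 0#) → ∃[ y ] x * y ≈ 1#
    +-monoˡ-≤       : ∀ z {x y} → x ≤ y → x + z ≤ y + z
    *-nonNegative   : ∀ {x y} → 0# ≤ x → 0# ≤ y → 0# ≤ x * y

  open IsDecTotalOrder isDecTotalOrder public
    using (_≟_; _≤?_; isTotalOrder; antisym; total)
    renaming (refl to ≤-refl; reflexive to ≤-reflexive; trans to ≤-trans)

  open NonStrictToStrict _≈_ _≤_ public using (_<_)

  open RawMonoidDefinitions +-rawMonoid public using (sum)

  -- Totalised division: x ÷ 0# is 0#.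
  infixl 7 _÷_
  _÷_ : Carrier → Carrier → Carrier
  x ÷ y with y ≟ 0#
  ... | yes _  = 0#
  ... | no y≉0 = x * proj₁ (inverse y y≉0)

------------------------------------------------------------------------
-- The problem p-Up-MCLP

module _ (F : OrderedField) where
  open OrderedField F

  -- "∈ ℝ⁺" is read as "non-negative" throughout, which includes the
  -- strictly positive case.

  record Instance : Set where
    field
      n m      : ℕ
      ends     : Fin m → Fin n × Fin n

    Joins : Fin m → Fin n → Fin n → Set
    Joins e i j = ends e ≡ (i , j) ⊎ ends e ≡ (j , i)

    field
      loopless : ∀ e i → ¬ Joins e i i
      simple   : ∀ {e f i j} → Joins e i j → Joins f i j → e ≡ f

      ℓ        : Fin m → Carrier
      0<ℓ      : ∀ e → 0# < ℓ e
      w        : Fin n → Carrier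
      0≤w      : ∀ i → 0# ≤ w i
      R        : Carrier
      0<R      : 0# < R
      u        : Fin m → Carrier
      0≤u      : ∀ e → 0# ≤ u e
      u<ℓ      : ∀ e → u e < ℓ e
      c        : Fin m → Carrier
      0≤c      : ∀ e → 0# ≤ c e
      B        : Carrier
      0≤B      : 0# ≤ B
      p        : ℕ
      p≤n      : p ℕ.≤ n

module _ {F : OrderedField} (I : Instance F) where
  open OrderedField F
  open Instance I

  data Walk : Fin n → Fin n → Set where
    stop : ∀ {i} → Walk i i
    step : ∀ {i j k} (e : Fin m) → Joins e i j → Walk j k → Walk i k

  vertices : ∀ {i j} → Walk i j → List (Fin n)
  vertices {i} stop         = i ∷ []
  vertices {i} (step e _ π) = i ∷ vertices π

  Path : Fin n → Fin n → Set
  Path i j = Σ (Walk i j) λ π → Unique (vertices π)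

  walkLength : (δ : Fin m → Carrier) → ∀ {i j} → Walk i j → Carrier
  walkLength δ stop         = 0#
  walkLength δ (step e _ π) = (ℓ e - δ e) + walkLength δ π

  pathLength : (δ : Fin m → Carrier) → ∀ {i j} → Path i j → Carrier
  pathLength δ (π , _) = walkLength δ π

  -- A relation rather than a function, since i and j may be disconnected.
  IsDistance : (δ : Fin m → Carrier) → Fin n → Fin n → Carrier → Set
  IsDistance δ i j d =
    (∃[ π ] pathLength δ {i} {j} π ≈ d) ×
    (∀ (π : Path i j) → d ≤ pathLength δ π)

  Covered : Subset n → (Fin m → Carrier) → Fin n → Set
  Covered X δ i = ∃[ j ] j Subset.∈ X × (∃[ d ] IsDistance δ i j d × d ≤ R)

  IsCoveredSet : Subset n → (Fin m → Carrier) → Subset n → Set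
  IsCoveredSet X δ C = ∀ i → i Subset.∈ C ⇔ Covered X δ i

  totalWeight : Subset n → Carrier
  totalWeight C = sum λ i → if lookup C i then w i else 0#

  Feasible : Subset n → (Fin m → Carrier) → Set
  Feasible X δ =
    (∣ X ∣ ≡ p) ×
    (∀ e → 0# ≤ δ e × δ e ≤ u e) ×
    (sum (λ e → c e * δ e) ≤ B)

  Optimal : Subset n → (Fin m → Carrier) → Set
  Optimal X δ =
    Feasible X δ ×
    (∃[ C ] IsCoveredSet X δ C ×
      (∀ X′ δ′ C′ → Feasible X′ δ′ → IsCoveredSet X′ δ′ C′ →
        totalWeight C′ ≤ totalWeight C))

  IsStarWithCentre : Fin n → Set
  IsStarWithCentre v₀ =
    (∀ e → ∃[ i ] i ≢ v₀ × Joins e v₀ i) ×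
    (∀ i → i ≢ v₀ → ∃[ e ] Joins e v₀ i)

  IsStar : Set
  IsStar = ∃[ v₀ ] IsStarWithCentre v₀

  UniformWeights : Set
  UniformWeights = ∃[ w₀ ] 0# ≤ w₀ × (∀ i → w i ≈ w₀)

------------------------------------------------------------------------
-- The machine model

-- Algorithms are closed terms of a small first-order, call-by-value
-- language, so that one finite program serves all instances and all
-- fields.  Numbers are opaque: they can only be combined by the four
-- arithmetic operations and compared.  Natural numbers serve as indices
-- and counters: they can only be incremented, decremented and compared.
-- Lists are immutable linked lists.
-- Every construct, not only arithmetic and comparisons, costs one unit
-- each time it is executed, so `cost` bounds the number of arithmetic
-- operations and comparisons from above, and no control or data
-- movement is free.

infixr 6 _⊗_

data Type : Set where
  num bool nat : Type
  _⊗_          : Type → Type → Type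
  list         : Type → Type

data ArithOp : Set where
  add sub mul div : ArithOp

Context : Set
Context = List Type

infix 4 _⊢_

data _⊢_ (Γ : Context) : Type → Set where
  var      : ∀ {A} → A ∈ Γ → Γ ⊢ A
  let′     : ∀ {A B} → Γ ⊢ A → A ∷ Γ ⊢ B → Γ ⊢ B
  -- Call of a closed, non-recursive procedure with one argument.
  call     : ∀ {A B} → A ∷ [] ⊢ B → Γ ⊢ A → Γ ⊢ B

  0′ 1′    : Γ ⊢ num
  arith    : ArithOp → Γ ⊢ num → Γ ⊢ num → Γ ⊢ num
  leq      : Γ ⊢ num → Γ ⊢ num → Γ ⊢ bool

  true′    : Γ ⊢ bool
  false′   : Γ ⊢ bool
  if′      : ∀ {A} → Γ ⊢ bool → Γ ⊢ A → Γ ⊢ A → Γ ⊢ A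

  zero′    : Γ ⊢ nat
  suc′     : Γ ⊢ nat → Γ ⊢ nat
  caseNat  : ∀ {A} → Γ ⊢ nat → Γ ⊢ A → nat ∷ Γ ⊢ A → Γ ⊢ A
  leqNat   : Γ ⊢ nat → Γ ⊢ nat → Γ ⊢ bool

  pair     : ∀ {A B} → Γ ⊢ A → Γ ⊢ B → Γ ⊢ A ⊗ B
  fst      : ∀ {A B} → Γ ⊢ A ⊗ B → Γ ⊢ A
  snd      : ∀ {A B} → Γ ⊢ A ⊗ B → Γ ⊢ B

  nil      : ∀ {A} → Γ ⊢ list A
  cons     : ∀ {A} → Γ ⊢ A → Γ ⊢ list A → Γ ⊢ list A
  caseList : ∀ {A B} → Γ ⊢ list A → Γ ⊢ B → A ∷ list A ∷ Γ ⊢ B → Γ ⊢ B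

  -- for k a t runs a := t(a) k times; foreach xs b t runs b := t(x , b)
  -- for the successive elements x of xs.
  for      : ∀ {A} → Γ ⊢ nat → Γ ⊢ A → A ∷ Γ ⊢ A → Γ ⊢ A
  foreach  : ∀ {A B} → Γ ⊢ list A → Γ ⊢ B → A ∷ B ∷ Γ ⊢ B → Γ ⊢ B

costIterate : ∀ {A : Set} → (A → ℕ) → (A → A) → A → ℕ → ℕ
costIterate κ f a zero    = 0
costIterate κ f a (suc k) = κ a ℕ.+ costIterate κ f (f a) k

costFoldl : ∀ {A B : Set} → (B → A → ℕ) → (B → A → B) → B → List A → ℕ
costFoldl κ f b []       = 0
costFoldl κ f b (x ∷ xs) = κ b x ℕ.+ costFoldl κ f (f b x) xs

module _ (F : OrderedField) where
  open OrderedField F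

  Val : Type → Set
  Val num      = Carrier
  Val bool     = Bool
  Val nat      = ℕ
  Val (A ⊗ B)  = Val A × Val B
  Val (list A) = List (Val A)

  Env : Context → Set
  Env = All Val

  ⟦_⟧op : ArithOp → Carrier → Carrier → Carrier
  ⟦ add ⟧op = _+_
  ⟦ sub ⟧op = _-_
  ⟦ mul ⟧op = _*_
  ⟦ div ⟧op = _÷_

  eval : ∀ {Γ A} → Γ ⊢ A → Env Γ → Val A

  evalCaseNat : ∀ {Γ A} → Γ ⊢ A → nat ∷ Γ ⊢ A → Env Γ → ℕ → Val A
  evalCaseNat s t ρ zero    = eval s ρ
  evalCaseNat s t ρ (suc k) = eval t (k ∷ ρ)

  evalCaseList : ∀ {Γ A B} → Γ ⊢ B → A ∷ list A ∷ Γ ⊢ B →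
                 Env Γ → List (Val A) → Val B
  evalCaseList s t ρ []       = eval s ρ
  evalCaseList s t ρ (x ∷ xs) = eval t (x ∷ xs ∷ ρ)

  eval (var x)            ρ = All.lookup ρ x
  eval (let′ s t)         ρ = eval t (eval s ρ ∷ ρ)
  eval (call f t)         ρ = eval f (eval t ρ ∷ [])
  eval 0′                 ρ = 0#
  eval 1′                 ρ = 1#
  eval (arith o s t)      ρ = ⟦ o ⟧op (eval s ρ) (eval t ρ)
  eval (leq s t)          ρ = ⌊ eval s ρ ≤? eval t ρ ⌋
  eval true′              ρ = true
  eval false′             ρ = false
  eval (if′ r s t)        ρ = if eval r ρ then eval s ρ else eval t ρ
  eval zero′              ρ = zero
  eval (suc′ t)           ρ = suc (eval t ρ)
  eval (caseNat r s t)    ρ = evalCaseNat s t ρ (eval r ρ)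
  eval (leqNat s t)       ρ = eval s ρ ℕ.≤ᵇ eval t ρ
  eval (pair s t)         ρ = eval s ρ , eval t ρ
  eval (fst t)            ρ = proj₁ (eval t ρ)
  eval (snd t)            ρ = proj₂ (eval t ρ)
  eval nil                ρ = []
  eval (cons s t)         ρ = eval s ρ ∷ eval t ρ
  eval (caseList r s t)   ρ = evalCaseList s t ρ (eval r ρ)
  eval (for r s t)        ρ = iterate (λ a → eval t (a ∷ ρ)) (eval s ρ) (eval r ρ)
  eval (foreach r s t)    ρ =
    foldl (λ b x → eval t (x ∷ b ∷ ρ)) (eval s ρ) (eval r ρ)

  cost : ∀ {Γ A} → Γ ⊢ A → Env Γ → ℕ

  costCaseNat : ∀ {Γ A} → Γ ⊢ A → nat ∷ Γ ⊢ A → Env Γ → ℕ → ℕ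
  costCaseNat s t ρ zero    = cost s ρ
  costCaseNat s t ρ (suc k) = cost t (k ∷ ρ)

  costCaseList : ∀ {Γ A B} → Γ ⊢ B → A ∷ list A ∷ Γ ⊢ B →
                 Env Γ → List (Val A) → ℕ
  costCaseList s t ρ []       = cost s ρ
  costCaseList s t ρ (x ∷ xs) = cost t (x ∷ xs ∷ ρ)

  cost (var x)            ρ = 1
  cost (let′ s t)         ρ = suc (cost s ρ ℕ.+ cost t (eval s ρ ∷ ρ))
  cost (call f t)         ρ = suc (cost t ρ ℕ.+ cost f (eval t ρ ∷ []))
  cost 0′                 ρ = 1
  cost 1′                 ρ = 1
  cost (arith o s t)      ρ = suc (cost s ρ ℕ.+ cost t ρ)
  cost (leq s t)          ρ = suc (cost s ρ ℕ.+ cost t ρ)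
  cost true′              ρ = 1
  cost false′             ρ = 1
  cost (if′ r s t)        ρ =
    suc (cost r ρ ℕ.+ (if eval r ρ then cost s ρ else cost t ρ))
  cost zero′              ρ = 1
  cost (suc′ t)           ρ = suc (cost t ρ)
  cost (caseNat r s t)    ρ = suc (cost r ρ ℕ.+ costCaseNat s t ρ (eval r ρ))
  cost (leqNat s t)       ρ = suc (cost s ρ ℕ.+ cost t ρ)
  cost (pair s t)         ρ = suc (cost s ρ ℕ.+ cost t ρ)
  cost (fst t)            ρ = suc (cost t ρ)
  cost (snd t)            ρ = suc (cost t ρ)
  cost nil                ρ = 1
  cost (cons s t)         ρ = suc (cost s ρ ℕ.+ cost t ρ)
  cost (caseList r s t)   ρ = suc (cost r ρ ℕ.+ costCaseList s t ρ (eval r ρ))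
  cost (for r s t)        ρ = suc (cost r ρ ℕ.+ cost s ρ ℕ.+
    costIterate (λ a → suc (cost t (a ∷ ρ))) (λ a → eval t (a ∷ ρ))
                (eval s ρ) (eval r ρ))
  cost (foreach r s t)    ρ = suc (cost r ρ ℕ.+ cost s ρ ℕ.+
    costFoldl (λ b x → suc (cost t (x ∷ b ∷ ρ))) (λ b x → eval t (x ∷ b ∷ ρ))
              (eval s ρ) (eval r ρ))

------------------------------------------------------------------------
-- Algorithms for p-Up-MCLP

-- An edge is given by its two end nodes followed by its length, its
-- upgrading bound and its cost.
Edge : Type
Edge = (nat ⊗ nat) ⊗ num ⊗ num ⊗ num

-- n, p, R, B, the node weights and the edges; the centre of a star is
-- not part of the input.
Input : Type
Input = nat ⊗ nat ⊗ num ⊗ num ⊗ list num ⊗ list Edge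

-- The nodes of X and the table of pairs (e , δ e), edges being numbered
-- by their position in the input; each list in any order.
Output : Type
Output = list nat ⊗ list (nat ⊗ num)

Program : Set
Program = Input ∷ [] ⊢ Output

module _ {F : OrderedField} (I : Instance F) where
  open OrderedField F
  open Instance I

  encodeEdge : Fin m → Val F Edge
  encodeEdge e =
    (toℕ (proj₁ (ends e)) , toℕ (proj₂ (ends e))) , ℓ e , u e , c e

  encode : Val F Input
  encode = n , p , R , B , List.tabulate w , List.tabulate encodeEdge

  Represents : Val F Output → Subset n → (Fin m → Carrier) → Set
  Represents (xs , ds) X δ =
    (xs ↭ List.map toℕ (filter (_∈? X) (allFin n))) ×
    (ds ↭ List.tabulate (λ e → toℕ e , δ e))

  Solves : Program → Set
  Solves P =
    ∃[ X ] ∃[ δ ] Represents (eval F P (encode ∷ [])) X δ × Optimal I X δ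

  runningTime : Program → ℕ
  runningTime P = cost F P (encode ∷ [])

module Submission where

open import Defs
import Algebra.Definitions.RawMonoid as RawMonoidDefinitions
import Algebra.Properties.AbelianGroup as AbelianGroupₚ
import Algebra.Properties.Ring as Ringₚ
open import Data.Bool.Base using (Bool; true; false; if_then_else_)
open import Data.Empty using (⊥; ⊥-elim)
open import Data.Fin.Base using (Fin; zero; suc; toℕ)
import Data.Fin.Properties as Finₚ
open import Data.Fin.Properties using () renaming (_≟_ to _≟ᶠ_)
open import Data.Fin.Subset
  using (Subset; Nonempty; ∣_∣; _∪_; _∩_; _─_; ⁅_⁆; inside; outside; _∈_; _∉_; _⊆_)
  renaming (⊥ to ∅; ⊤ to full)
import Data.Fin.Subset.Properties as Subsetₚ
open import Data.Fin.Subset.Properties using (_∈?_)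
open import Data.List.Base
  using (List; []; _∷_; [_]; length; map; foldr; foldl; _++_; _ʳ++_; reverse; concat; merge;
         tabulate; allFin; take; filter)
import Data.List.Membership.DecPropositional as DecMembership
import Data.List.Membership.Propositional as List
import Data.List.Membership.Propositional.Properties as Memₚ
open import Data.List.Membership.Propositional.Properties.WithK using (unique∧set⇒bag)
import Data.List.Properties as Listₚ
open import Data.List.Relation.Binary.BagAndSetEquality using (∼bag⇒↭)
open import Data.List.Relation.Binary.Permutation.Propositional
  using (_↭_; ↭-refl; ↭-reflexive; ↭-prep; ↭-sym; ↭-trans; ↭⇒↭ₛ; module PermutationReasoning)
import Data.List.Relation.Binary.Permutation.Propositional.Properties as Perm
import Data.List.Relation.Binary.Permutation.Setoid.Properties as Permₛ
open import Data.List.Relation.Unary.All as All using (All; []; _∷_)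
import Data.List.Relation.Unary.All.Properties as Allₚ
open import Data.List.Relation.Unary.AllPairs using ([]; _∷_)
open import Data.List.Relation.Unary.Any using (here; there)
open import Data.List.Relation.Unary.Linked as Linked using (Linked; []; [-]; _∷_)
import Data.List.Relation.Unary.Linked.Properties as Linkedₚ
import Data.List.Relation.Unary.Sorted.TotalOrder as Sortedness
open import Data.List.Relation.Unary.Unique.Propositional using (Unique)
import Data.List.Relation.Unary.Unique.Propositional.Properties as Uniqueₚ
import Data.List.Sort.MergeSort.Base as StdMergeSort
import Data.List.Sort.MergeSort.Properties as StdMergeSortₚ
open import Data.Nat.Base as ℕ using (ℕ; zero; suc; z≤n; s≤s; _∸_; _≤ᵇ_)
open import Data.Nat.GeneralisedArithmetic using (iterate)
open import Data.Nat.Logarithm using (⌈log₂_⌉; ⌈log₂⌉-mono-≤; ⌈log₂⌈n/2⌉⌉≡⌈log₂n⌉∸1)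
import Data.Nat.Properties as ℕₚ
open import Data.Nat.Tactic.RingSolver using (solve-∀)
open import Data.Product using (Σ-syntax; ∃; ∃-syntax; _×_; _,_; proj₁; proj₂)
open import Data.Sum.Base as Sum using (_⊎_; inj₁; inj₂)
open import Data.Unit.Base using (⊤)
open import Data.Vec.Base as Vec using ([]; _∷_; lookup)
open import Function.Base using (_∘_; flip; id)
open import Function.Bundles using (mk⇔; Equivalence)
open import Level using (0ℓ)
open import Relation.Binary.Bundles using (DecTotalOrder; Poset)
import Relation.Binary.Construct.On as On
import Relation.Binary.Reasoning.PartialOrder as PartialOrderReasoning
open import Relation.Binary.PropositionalEquality as ≡ using (_≡_; _≢_; cong; cong₂; subst)
open import Relation.Nullary
  using (¬_; Dec; yes; no; ⌊_⌋; contradiction; ¬?; _×-dec_; decidable-stable)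
open import Relation.Unary using (Pred; Decidable)

-- It is never worse to put a facility at the centre v₀: if a node without a
-- facility is covered, then so is v₀, by a satellite facility that may be
-- moved to v₀.  With a facility at v₀, a satellite i is covered as soon as
-- it has a facility or its edge is reduced by max(0, ℓᵢ − R), which must not
-- exceed uᵢ and then costs cᵢ max(0, ℓᵢ − R).  So sort the satellites by this
-- cost, place the p − 1 remaining facilities on the most expensive ones, and
-- upgrade the others greedily from the cheapest.

-- Cost of terms whose loops are not nested

-- No rival solution is ever transformed. Weights being uniform, optimality is a matter of counting:
-- a rival that covers a node without a facility has a facility near the centre, and this facility
-- makes up for the centre in the count. So it covers at most `p + r` nodes, where `r` is at most
-- `n - p` and the `r` smallest keys together fit the budget. The greedy choice upgrades at least
-- `r` satellites and reaches this bound. The machine shapes the rest. Programs have no recursion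
-- and no arrays, and every loop has a number of rounds fixed on entry. Sorting is therefore a
-- bottom-up merge sort with reversed accumulators. It is the only code with nested loops and has
-- its own cost analysis; elsewhere the size of the term times the number of rounds is a good enough
-- bound. The centre has to be found from the edges, and a single edge has two centres, so the proof
-- follows the one that the program finds.

module CostBounds where
  open import Data.Nat.Base using (_+_; _*_; _≤_)
  open ≡ using (sym)

  -- Both branches of a conditional count, which keeps the measure independent of the environment.
  -- The extra `suc` on a loop body is the tick that `cost` charges for each round.
  size : ∀ {Γ A} → Γ ⊢ A → ℕ
  size (var _)          = 1
  size (let′ s t)       = suc (size s + size t)
  size (call f t)       = suc (size t + size f)
  size 0′               = 1
  size 1′               = 1
  size (arith _ s t)    = suc (size s + size t)
  size (leq s t)        = suc (size s + size t)
  size true′            = 1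
  size false′           = 1
  size (if′ r s t)      = suc (size r + (size s + size t))
  size zero′            = 1
  size (suc′ t)         = suc (size t)
  size (caseNat r s t)  = suc (size r + (size s + size t))
  size (leqNat s t)     = suc (size s + size t)
  size (pair s t)       = suc (size s + size t)
  size (fst t)          = suc (size t)
  size (snd t)          = suc (size t)
  size nil              = 1
  size (cons s t)       = suc (size s + size t)
  size (caseList r s t) = suc (size r + (size s + size t))
  size (for r s t)      = suc (size r + size s + suc (size t))
  size (foreach r s t)  = suc (size r + size s + suc (size t))

  LoopFree : ∀ {Γ A} → Γ ⊢ A → Set
  LoopFree (var _)          = ⊤
  LoopFree (let′ s t)       = LoopFree s × LoopFree t
  LoopFree (call f t)       = LoopFree t × LoopFree f
  LoopFree 0′               = ⊤
  LoopFree 1′               = ⊤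
  LoopFree (arith _ s t)    = LoopFree s × LoopFree t
  LoopFree (leq s t)        = LoopFree s × LoopFree t
  LoopFree true′            = ⊤
  LoopFree false′           = ⊤
  LoopFree (if′ r s t)      = LoopFree r × LoopFree s × LoopFree t
  LoopFree zero′            = ⊤
  LoopFree (suc′ t)         = LoopFree t
  LoopFree (caseNat r s t)  = LoopFree r × LoopFree s × LoopFree t
  LoopFree (leqNat s t)     = LoopFree s × LoopFree t
  LoopFree (pair s t)       = LoopFree s × LoopFree t
  LoopFree (fst t)          = LoopFree t
  LoopFree (snd t)          = LoopFree t
  LoopFree nil              = ⊤
  LoopFree (cons s t)       = LoopFree s × LoopFree t
  LoopFree (caseList r s t) = LoopFree r × LoopFree s × LoopFree t
  LoopFree (for _ _ _)      = ⊥
  LoopFree (foreach _ _ _)  = ⊥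

  private
    binary : ∀ N c d {a b} → a ≤ c * suc N → b ≤ d * suc N →
             suc (a + b) ≤ suc (c + d) * suc N
    binary N c d p q = s≤s (ℕₚ.≤-trans (ℕₚ.+-mono-≤ p q)
      (ℕₚ.≤-trans (ℕₚ.≤-reflexive (sym (ℕₚ.*-distribʳ-+ (suc N) c d)))
                  (ℕₚ.m≤n+m _ N)))

    unary : ∀ N c {a} → a ≤ c * suc N → suc a ≤ suc c * suc N
    unary N c p = s≤s (ℕₚ.≤-trans p (ℕₚ.m≤n+m _ N))

    branchˡ : ∀ N c d e {a b} → a ≤ c * suc N → b ≤ d * suc N →
              suc (a + b) ≤ suc (c + (d + e)) * suc N
    branchˡ N c d e p q =
      binary N c (d + e) p (ℕₚ.≤-trans q (ℕₚ.*-monoˡ-≤ (suc N) (ℕₚ.m≤m+n d e)))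

    branchʳ : ∀ N c d e {a b} → a ≤ c * suc N → b ≤ e * suc N →
              suc (a + b) ≤ suc (c + (d + e)) * suc N
    branchʳ N c d e p q =
      binary N c (d + e) p (ℕₚ.≤-trans q (ℕₚ.*-monoˡ-≤ (suc N) (ℕₚ.m≤n+m e d)))

    loop : ∀ N c d k {a b l n} → a ≤ c * suc N → b ≤ d * suc N →
           l ≤ n * k → n ≤ N → suc (a + b + l) ≤ suc (c + d + k) * suc N
    loop N c d k p q r n≤N = binary N (c + d) k
      (ℕₚ.≤-trans (ℕₚ.+-mono-≤ p q)
                  (ℕₚ.≤-reflexive (sym (ℕₚ.*-distribʳ-+ (suc N) c d))))
      (ℕₚ.≤-trans r (ℕₚ.≤-trans (ℕₚ.*-monoˡ-≤ k (ℕₚ.m≤n⇒m≤1+n n≤N))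
                                (ℕₚ.≤-reflexive (ℕₚ.*-comm (suc N) k))))

  costIterate≤ : ∀ {A : Set} {κ : A → ℕ} {f : A → A} k → (∀ a → κ a ≤ k) →
                 ∀ a n → costIterate κ f a n ≤ n * k
  costIterate≤ k κ≤k a zero    = z≤n
  costIterate≤ k κ≤k a (suc n) = ℕₚ.+-mono-≤ (κ≤k a) (costIterate≤ k κ≤k _ n)

  costFoldl≤ : ∀ {A B : Set} {κ : B → A → ℕ} {f : B → A → B} k →
               (∀ b x → κ b x ≤ k) → ∀ b xs → costFoldl κ f b xs ≤ length xs * k
  costFoldl≤ k κ≤k b []       = z≤n
  costFoldl≤ k κ≤k b (x ∷ xs) = ℕₚ.+-mono-≤ (κ≤k b x) (costFoldl≤ k κ≤k _ xs)

  module _ (F : OrderedField) where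

    -- Every loop executed in evaluating the term has a loop-free body and
    -- at most N rounds; branches that are not taken are unconstrained.
    Loops≤ : ℕ → ∀ {Γ A} → Γ ⊢ A → Env F Γ → Set

    Loops≤CaseNat : ℕ → ∀ {Γ A} → Γ ⊢ A → nat ∷ Γ ⊢ A → Env F Γ → ℕ → Set
    Loops≤CaseNat N s t ρ zero    = Loops≤ N s ρ
    Loops≤CaseNat N s t ρ (suc k) = Loops≤ N t (k ∷ ρ)

    Loops≤CaseList : ℕ → ∀ {Γ A B} → Γ ⊢ B → A ∷ list A ∷ Γ ⊢ B →
                     Env F Γ → List (Val F A) → Set
    Loops≤CaseList N s t ρ []       = Loops≤ N s ρ
    Loops≤CaseList N s t ρ (x ∷ xs) = Loops≤ N t (x ∷ xs ∷ ρ)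

    Loops≤ N (var _)          ρ = ⊤
    Loops≤ N (let′ s t)       ρ = Loops≤ N s ρ × Loops≤ N t (eval F s ρ ∷ ρ)
    Loops≤ N (call f t)       ρ = Loops≤ N t ρ × Loops≤ N f (eval F t ρ ∷ [])
    Loops≤ N 0′               ρ = ⊤
    Loops≤ N 1′               ρ = ⊤
    Loops≤ N (arith _ s t)    ρ = Loops≤ N s ρ × Loops≤ N t ρ
    Loops≤ N (leq s t)        ρ = Loops≤ N s ρ × Loops≤ N t ρ
    Loops≤ N true′            ρ = ⊤
    Loops≤ N false′           ρ = ⊤
    Loops≤ N (if′ r s t)      ρ =
      Loops≤ N r ρ × (if eval F r ρ then Loops≤ N s ρ else Loops≤ N t ρ)
    Loops≤ N zero′            ρ = ⊤
    Loops≤ N (suc′ t)         ρ = Loops≤ N t ρ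
    Loops≤ N (caseNat r s t)  ρ =
      Loops≤ N r ρ × Loops≤CaseNat N s t ρ (eval F r ρ)
    Loops≤ N (leqNat s t)     ρ = Loops≤ N s ρ × Loops≤ N t ρ
    Loops≤ N (pair s t)       ρ = Loops≤ N s ρ × Loops≤ N t ρ
    Loops≤ N (fst t)          ρ = Loops≤ N t ρ
    Loops≤ N (snd t)          ρ = Loops≤ N t ρ
    Loops≤ N nil              ρ = ⊤
    Loops≤ N (cons s t)       ρ = Loops≤ N s ρ × Loops≤ N t ρ
    Loops≤ N (caseList r s t) ρ =
      Loops≤ N r ρ × Loops≤CaseList N s t ρ (eval F r ρ)
    Loops≤ N (for r s t)      ρ =
      Loops≤ N r ρ × Loops≤ N s ρ × LoopFree t × eval F r ρ ≤ N
    Loops≤ N (foreach r s t)  ρ =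
      Loops≤ N r ρ × Loops≤ N s ρ × LoopFree t × length (eval F r ρ) ≤ N

    loopFree⇒loops≤ : ∀ N {Γ A} (t : Γ ⊢ A) → LoopFree t → ∀ ρ → Loops≤ N t ρ
    loopFree⇒loops≤ N (var _)       _       ρ = _
    loopFree⇒loops≤ N (let′ s t)    (p , q) ρ =
      loopFree⇒loops≤ N s p ρ , loopFree⇒loops≤ N t q _
    loopFree⇒loops≤ N (call f t)    (p , q) ρ =
      loopFree⇒loops≤ N t p ρ , loopFree⇒loops≤ N f q _
    loopFree⇒loops≤ N 0′            _       ρ = _
    loopFree⇒loops≤ N 1′            _       ρ = _
    loopFree⇒loops≤ N (arith _ s t) (p , q) ρ =
      loopFree⇒loops≤ N s p ρ , loopFree⇒loops≤ N t q ρ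
    loopFree⇒loops≤ N (leq s t)     (p , q) ρ =
      loopFree⇒loops≤ N s p ρ , loopFree⇒loops≤ N t q ρ
    loopFree⇒loops≤ N true′         _       ρ = _
    loopFree⇒loops≤ N false′        _       ρ = _
    loopFree⇒loops≤ N (if′ r s t)   (p , q , o) ρ with eval F r ρ
    ... | true  = loopFree⇒loops≤ N r p ρ , loopFree⇒loops≤ N s q ρ
    ... | false = loopFree⇒loops≤ N r p ρ , loopFree⇒loops≤ N t o ρ
    loopFree⇒loops≤ N zero′         _       ρ = _
    loopFree⇒loops≤ N (suc′ t)      p       ρ = loopFree⇒loops≤ N t p ρ
    loopFree⇒loops≤ N (caseNat r s t) (p , q , o) ρ with eval F r ρ
    ... | zero  = loopFree⇒loops≤ N r p ρ , loopFree⇒loops≤ N s q ρ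
    ... | suc _ = loopFree⇒loops≤ N r p ρ , loopFree⇒loops≤ N t o _
    loopFree⇒loops≤ N (leqNat s t)  (p , q) ρ =
      loopFree⇒loops≤ N s p ρ , loopFree⇒loops≤ N t q ρ
    loopFree⇒loops≤ N (pair s t)    (p , q) ρ =
      loopFree⇒loops≤ N s p ρ , loopFree⇒loops≤ N t q ρ
    loopFree⇒loops≤ N (fst t)       p       ρ = loopFree⇒loops≤ N t p ρ
    loopFree⇒loops≤ N (snd t)       p       ρ = loopFree⇒loops≤ N t p ρ
    loopFree⇒loops≤ N nil           _       ρ = _
    loopFree⇒loops≤ N (cons s t)    (p , q) ρ =
      loopFree⇒loops≤ N s p ρ , loopFree⇒loops≤ N t q ρ
    loopFree⇒loops≤ N (caseList r s t) (p , q , o) ρ with eval F r ρ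
    ... | []    = loopFree⇒loops≤ N r p ρ , loopFree⇒loops≤ N s q ρ
    ... | _ ∷ _ = loopFree⇒loops≤ N r p ρ , loopFree⇒loops≤ N t o _

    -- The case `N = 0` of `cost≤`, with which it is mutually recursive: the bound for a loop needs
    -- the cost of its body, a proper subterm without loops.
    cost≤size : ∀ {Γ A} (t : Γ ⊢ A) → LoopFree t → ∀ ρ → cost F t ρ ≤ size t

    -- Loop bodies contain no loops, so a construct runs at most once, or at most once in each of
    -- `N` rounds. The factor is `suc N` so that constructs outside loops are paid for even when `N`
    -- is 0.
    cost≤ : ∀ N {Γ A} (t : Γ ⊢ A) ρ → Loops≤ N t ρ →
            cost F t ρ ≤ size t * suc N
    cost≤ N (var _)       ρ _       = s≤s z≤n
    cost≤ N (let′ s t)    ρ (p , q) =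
      binary N (size s) (size t) (cost≤ N s ρ p) (cost≤ N t _ q)
    cost≤ N (call f t)    ρ (p , q) =
      binary N (size t) (size f) (cost≤ N t ρ p) (cost≤ N f _ q)
    cost≤ N 0′            ρ _       = s≤s z≤n
    cost≤ N 1′            ρ _       = s≤s z≤n
    cost≤ N (arith _ s t) ρ (p , q) =
      binary N (size s) (size t) (cost≤ N s ρ p) (cost≤ N t ρ q)
    cost≤ N (leq s t)     ρ (p , q) =
      binary N (size s) (size t) (cost≤ N s ρ p) (cost≤ N t ρ q)
    cost≤ N true′         ρ _       = s≤s z≤n
    cost≤ N false′        ρ _       = s≤s z≤n
    cost≤ N (if′ r s t)   ρ (p , q) with eval F r ρ
    ... | true  = branchˡ N (size r) (size s) (size t)
                           (cost≤ N r ρ p) (cost≤ N s ρ q)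
    ... | false = branchʳ N (size r) (size s) (size t)
                           (cost≤ N r ρ p) (cost≤ N t ρ q)
    cost≤ N zero′         ρ _       = s≤s z≤n
    cost≤ N (suc′ t)      ρ p       = unary N (size t) (cost≤ N t ρ p)
    cost≤ N (caseNat r s t) ρ (p , q) with eval F r ρ
    ... | zero  = branchˡ N (size r) (size s) (size t)
                           (cost≤ N r ρ p) (cost≤ N s ρ q)
    ... | suc _ = branchʳ N (size r) (size s) (size t)
                           (cost≤ N r ρ p) (cost≤ N t _ q)
    cost≤ N (leqNat s t)  ρ (p , q) =
      binary N (size s) (size t) (cost≤ N s ρ p) (cost≤ N t ρ q)
    cost≤ N (pair s t)    ρ (p , q) =
      binary N (size s) (size t) (cost≤ N s ρ p) (cost≤ N t ρ q)
    cost≤ N (fst t)       ρ p       = unary N (size t) (cost≤ N t ρ p)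
    cost≤ N (snd t)       ρ p       = unary N (size t) (cost≤ N t ρ p)
    cost≤ N nil           ρ _       = s≤s z≤n
    cost≤ N (cons s t)    ρ (p , q) =
      binary N (size s) (size t) (cost≤ N s ρ p) (cost≤ N t ρ q)
    cost≤ N (caseList r s t) ρ (p , q) with eval F r ρ
    ... | []    = branchˡ N (size r) (size s) (size t)
                           (cost≤ N r ρ p) (cost≤ N s ρ q)
    ... | _ ∷ _ = branchʳ N (size r) (size s) (size t)
                           (cost≤ N r ρ p) (cost≤ N t _ q)
    cost≤ N (for r s t)   ρ (p , q , o , n≤N) =
      loop N (size r) (size s) (suc (size t))
        (cost≤ N r ρ p) (cost≤ N s ρ q)
        (costIterate≤ (suc (size t)) (λ a → s≤s (cost≤size t o _)) _ (eval F r ρ)) n≤N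
    cost≤ N (foreach r s t) ρ (p , q , o , n≤N) =
      loop N (size r) (size s) (suc (size t))
        (cost≤ N r ρ p) (cost≤ N s ρ q)
        (costFoldl≤ (suc (size t)) (λ b x → s≤s (cost≤size t o _)) _ (eval F r ρ)) n≤N

    cost≤size t p ρ = subst (cost F t ρ ≤_) (ℕₚ.*-identityʳ (size t))
      (cost≤ 0 t ρ (loopFree⇒loops≤ 0 t p ρ))

open CostBounds

-- Bottom-up merge sort as a program: correctness and cost

module MergeSort where
  open import Data.Nat.Base using (_+_; _*_; _≤_; ⌈_/2⌉)
  open ≡ using (refl; sym; trans; module ≡-Reasoning)

  #0 : ∀ {Γ A} → A ∷ Γ ⊢ A
  #0 = var (here refl)

  #1 : ∀ {Γ A B} → B ∷ A ∷ Γ ⊢ A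
  #1 = var (there (here refl))

  #2 : ∀ {Γ A B C} → C ∷ B ∷ A ∷ Γ ⊢ A
  #2 = var (there (there (here refl)))

  #3 : ∀ {Γ A B C D} → D ∷ C ∷ B ∷ A ∷ Γ ⊢ A
  #3 = var (there (there (there (here refl))))

  #4 : ∀ {Γ A B C D E} → E ∷ D ∷ C ∷ B ∷ A ∷ Γ ⊢ A
  #4 = var (there (there (there (there (here refl)))))

  -- Sort key, edge number, satellite, and the reduction of the edge that
  -- brings the satellite within the coverage radius of the centre.
  Item : Type
  Item = num ⊗ nat ⊗ nat ⊗ num

  lengthₚ : ∀ {A} → list A ∷ [] ⊢ nat
  lengthₚ = foreach #0 zero′ (suc′ #1)

  -- The lists still to be merged and the reversed output.
  MergeState : Type
  MergeState = list Item ⊗ list Item ⊗ list Item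

  mergeStepₚ : MergeState ∷ [] ⊢ MergeState
  mergeStepₚ =
    caseList (fst #0)
      (caseList (fst (snd #0))
        #0
        (pair nil (pair #1 (cons #0 (snd (snd #2))))))
      (caseList (fst (snd #2))
        (pair #1 (pair nil (cons #0 (snd (snd #2)))))
        (if′ (leq (fst #2) (fst #0))
          (pair #3 (pair (fst (snd #4)) (cons #2 (snd (snd #4)))))
          (pair (fst #4) (pair #1 (cons #0 (snd (snd #4)))))))

  -- The number of rounds must be known on entry. A step moves one item, so the sum of the two
  -- lengths is exactly what is needed; the outer `foreach` undoes the reversal of the accumulated
  -- output.
  mergeₚ : list Item ⊗ list Item ∷ [] ⊢ list Item
  mergeₚ =
    foreach
      (snd (snd
        (for (foreach (fst #0) (foreach (snd #0) zero′ (suc′ #1)) (suc′ #1))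
             (pair (fst #0) (pair (snd #0) nil))
             (call mergeStepₚ #0))))
      nil
      (cons #0 #1)

  -- The flag tells whether the head of the output awaits a partner.
  PairState : Type
  PairState = bool ⊗ list (list Item)

  pairStepₚ : list Item ⊗ PairState ∷ [] ⊢ PairState
  pairStepₚ =
    if′ (fst (snd #0))
      (caseList (snd (snd #0))
        -- Never reached: the flag is set only by the branch that has just put a list at the head.
        (pair false′ nil)
        (pair false′ (cons (call mergeₚ (pair #0 (fst #2))) #1)))
      (pair true′ (cons (fst #0) (snd (snd #0))))

  pairBody : list Item ∷ PairState ∷ list (list Item) ∷ [] ⊢ PairState
  pairBody = call pairStepₚ (pair #0 #1)

  mergePairsₚ : list (list Item) ∷ [] ⊢ list (list Item)
  mergePairsₚ = snd (foreach #0 (pair false′ nil) pairBody)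

  -- Returning at once on at most one list makes the surplus rounds of the
  -- loop in sortₚ cheap.
  roundₚ : list (list Item) ∷ [] ⊢ list (list Item)
  roundₚ = caseList #0 nil (caseList #1 #2 (call mergePairsₚ #4))

  countₜ : list Item ∷ [] ⊢ nat
  countₜ = call lengthₚ #0

  initialₜ : list Item ∷ [] ⊢ list (list Item)
  initialₜ = foreach #0 nil (cons (cons #0 nil) #1)

  -- The length of the input is a simple bound for the number of halvings. Only logarithmically many
  -- of these rounds still find two lists to merge.
  sortₚ : list Item ∷ [] ⊢ list Item
  sortₚ = caseList (for countₜ initialₜ (call roundₚ #0)) nil #0

  -- In `18 = 15 + 3`, the 15 bounds what a round of `sortₚ` costs apart from merging, and the 3
  -- pays for the case distinction, the loop construct and the returned term. `mergeFactor` includes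
  -- the tick of a round in `mergePairsₚ`.
  linearFactor mergeFactor : ℕ
  linearFactor = size countₜ + size initialₜ + 18
  mergeFactor  = suc (size pairBody)

  foldl-count : ∀ {A : Set} k (xs : List A) → foldl (λ n _ → suc n) k xs ≡ k + length xs
  foldl-count k []       = sym (ℕₚ.+-identityʳ k)
  foldl-count k (x ∷ xs) = trans (foldl-count (suc k) xs) (sym (ℕₚ.+-suc k (length xs)))

  mergeRounds : ∀ {A : Set} (xs ys : List A) →
    foldl (λ k _ → suc k) (foldl (λ k _ → suc k) 0 ys) xs ≡ length xs + length ys
  mergeRounds xs ys = begin
    foldl (λ k _ → suc k) (foldl (λ k _ → suc k) 0 ys) xs ≡⟨ foldl-count _ xs ⟩
    foldl (λ k _ → suc k) 0 ys + length xs
      ≡⟨ cong (_+ length xs) (foldl-count 0 ys) ⟩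
    length ys + length xs                                 ≡⟨ ℕₚ.+-comm (length ys) (length xs) ⟩
    length xs + length ys                                 ∎
    where open ≡-Reasoning

  module _ (F : OrderedField) where
    open OrderedField F using (isDecTotalOrder)

    itemOrder : DecTotalOrder _ _ _
    itemOrder =
      On.decTotalOrder (record { isDecTotalOrder = isDecTotalOrder })
        (proj₁ {B = λ (_ : Val F num) → Val F (nat ⊗ nat ⊗ num)})

    open DecTotalOrder itemOrder using (totalOrder) renaming (_≤?_ to _⊑?_)
    open Sortedness totalOrder using (Sorted)
    open StdMergeSort itemOrder using (mergePairs)
    open StdMergeSortₚ itemOrder using (mergePairs-↭; mergePairs-↗)

    private
      V : Type → Set
      V = Val F

      run : ∀ {A B} → A ∷ [] ⊢ B → V A → V B
      run f a = eval F f (a ∷ [])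

      tick : ∀ {A B} → A ∷ [] ⊢ B → V A → ℕ
      tick f a = cost F f (a ∷ [])

    merge-[] : ∀ (xs : List (V Item)) → merge _⊑?_ xs [] ≡ xs
    merge-[] []       = refl
    merge-[] (x ∷ xs) = refl

    -- Each step takes one item off the two lists, so the count is used up just when both are empty.
    -- The accumulator `zs` is arbitrary to let the induction pass through.
    eval-mergeSteps : ∀ (xs ys zs : List (V Item)) →
      iterate (run mergeStepₚ) (xs , ys , zs) (length xs + length ys) ≡
      ([] , [] , merge _⊑?_ xs ys ʳ++ zs)
    eval-mergeSteps []       []       zs = refl
    eval-mergeSteps []       (y ∷ ys) zs = eval-mergeSteps [] ys (y ∷ zs)
    eval-mergeSteps (x ∷ xs) []       zs =
      trans (eval-mergeSteps xs [] (x ∷ zs)) (cong (λ l → [] , [] , l ʳ++ (x ∷ zs)) (merge-[] xs))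
    eval-mergeSteps (x ∷ xs) (y ∷ ys) zs
      with OrderedField._≤?_ F (proj₁ x) (proj₁ y)
         | eval-mergeSteps xs (y ∷ ys) (x ∷ zs)
         | eval-mergeSteps (x ∷ xs) ys (y ∷ zs)
    ... | yes _ | eq | _  = eq
    ... | no  _ | _  | eq = trans
      (cong (iterate (run mergeStepₚ) (x ∷ xs , ys , y ∷ zs)) (ℕₚ.+-suc (length xs) (length ys)))
      eq

    eval-merge : ∀ (xs ys : List (V Item)) → run mergeₚ (xs , ys) ≡ merge _⊑?_ xs ys
    eval-merge xs ys = begin
      foldl (flip _∷_) [] (proj₂ (proj₂ (steps rounds)))
        ≡⟨ cong (λ k → foldl (flip _∷_) [] (proj₂ (proj₂ (steps k)))) (mergeRounds xs ys) ⟩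
      foldl (flip _∷_) [] (proj₂ (proj₂ (steps (length xs + length ys))))
        ≡⟨ cong (λ s → foldl (flip _∷_) [] (proj₂ (proj₂ s))) (eval-mergeSteps xs ys []) ⟩
      reverse (reverse (merge _⊑?_ xs ys))
        ≡⟨ Listₚ.reverse-involutive _ ⟩
      merge _⊑?_ xs ys ∎
      where
      open ≡-Reasoning
      steps  = iterate (run mergeStepₚ) (xs , ys , [])
      rounds = foldl (λ k _ → suc k) (foldl (λ k _ → suc k) 0 ys) xs

    loops-merge : ∀ xs ys → Loops≤ F (length xs + length ys) mergeₚ ((xs , ys) ∷ [])
    loops-merge xs ys =
      ((_ , (_ , _ , _ , ℕₚ.m≤n+m _ (length xs)) , _ , ℕₚ.m≤m+n _ _) , _ , _ ,
       ℕₚ.≤-reflexive (mergeRounds xs ys)) , _ , _ , ℕₚ.≤-reflexive len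
      where
      open ≡-Reasoning
      output = length ∘ proj₂ ∘ proj₂
      steps  = iterate (run mergeStepₚ) (xs , ys , [])
      rounds = foldl (λ k _ → suc k) (foldl (λ k _ → suc k) 0 ys) xs

      len : output (steps rounds) ≡ length xs + length ys
      len = begin
        output (steps rounds)                  ≡⟨ cong (output ∘ steps) (mergeRounds xs ys) ⟩
        output (steps (length xs + length ys)) ≡⟨ cong output (eval-mergeSteps xs ys []) ⟩
        length (reverse (merge _⊑?_ xs ys))    ≡⟨ Listₚ.length-reverse (merge _⊑?_ xs ys) ⟩
        length (merge _⊑?_ xs ys)              ≡⟨ Perm.↭-length (Perm.merge-↭ _⊑?_ xs ys) ⟩
        length (xs ++ ys)                      ≡⟨ Listₚ.length-++ xs ⟩
        length xs + length ys                  ∎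

    -- `mergePairs` consumes two lists at a time and the fold only one, so the induction goes by
    -- pairs, each pair starting with the flag `false`.
    eval-pairSteps : ∀ xss yss →
      proj₂ (foldl (λ s xs → run pairStepₚ (xs , s)) (false , yss) xss) ≡ mergePairs xss ʳ++ yss
    eval-pairSteps []               zss = refl
    eval-pairSteps (xs ∷ [])        zss = refl
    eval-pairSteps (xs ∷ ys ∷ xss) zss =
      trans (eval-pairSteps xss (run mergeₚ (xs , ys) ∷ zss))
            (cong (λ zs → mergePairs xss ʳ++ (zs ∷ zss)) (eval-merge xs ys))

    eval-mergePairs : ∀ xss → run mergePairsₚ xss ≡ reverse (mergePairs xss)
    eval-mergePairs xss = eval-pairSteps xss []

    private
      pairCost-first : ∀ ρ xs yss → cost F pairBody (xs ∷ (false , yss) ∷ ρ) ≤ size pairBody * 1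
      pairCost-first ρ xs yss = cost≤ F 0 pairBody (xs ∷ (false , yss) ∷ ρ) _

      pairCost-second : ∀ ρ xs ys yss →
        cost F pairBody (ys ∷ (true , xs ∷ yss) ∷ ρ) ≤ size pairBody * suc (length xs + length ys)
      pairCost-second ρ xs ys yss =
        cost≤ F (length xs + length ys) pairBody (ys ∷ (true , xs ∷ yss) ∷ ρ)
          (_ , _ , _ , _ , (_ , loops-merge xs ys) , _)

    -- A round with the flag unset has constant cost; the next one is linear in the items of the two
    -- lists that it merges. One unit of `mergeFactor` for each list and each item pays for both.
    cost-pairSteps : ∀ ρ xss yss →
      costFoldl (λ s xs → suc (cost F pairBody (xs ∷ s ∷ ρ)))
                (λ s xs → eval F pairBody (xs ∷ s ∷ ρ)) (false , yss) xss ≤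
      (length xss + length (concat xss)) * mergeFactor
    cost-pairSteps ρ []              zss = z≤n
    cost-pairSteps ρ (xs ∷ [])       zss =
      ℕₚ.≤-trans (ℕₚ.+-monoˡ-≤ 0 (s≤s (pairCost-first ρ xs zss)))
                 (bound₁ (size pairBody) (length (xs ++ [])))
      where
      bound₁ : ∀ s l → suc (s * 1) + 0 ≤ (1 + l) * suc s
      bound₁ s l = ℕₚ.≤-trans
        (ℕₚ.≤-reflexive (trans (ℕₚ.+-identityʳ _) (cong suc (ℕₚ.*-identityʳ s))))
        (ℕₚ.m≤m+n (suc s) (l * suc s))
    cost-pairSteps ρ (xs ∷ ys ∷ xss) zss = begin
      suc (cost F pairBody (xs ∷ (false , zss) ∷ ρ)) +
        (suc (cost F pairBody (ys ∷ (true , xs ∷ zss) ∷ ρ)) + rest)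
        ≤⟨ ℕₚ.+-mono-≤ (s≤s (pairCost-first ρ xs zss))
             (ℕₚ.+-mono-≤ (s≤s (pairCost-second ρ xs ys zss))
                          (cost-pairSteps ρ xss (run mergeₚ (xs , ys) ∷ zss))) ⟩
      suc (size pairBody * 1) +
        (suc (size pairBody * suc (length xs + length ys)) +
         (length xss + length (concat xss)) * mergeFactor)
        ≤⟨ bound₂ (size pairBody) (length xs + length ys) (length xss) (length (concat xss)) ⟩
      (2 + length xss + (length xs + length ys + length (concat xss))) * mergeFactor
        ≡⟨ cong (λ l → (2 + length xss + l) * mergeFactor) (sym lengths) ⟩
      (2 + length xss + length (xs ++ ys ++ concat xss)) * mergeFactor ∎
      where
      open ℕₚ.≤-Reasoning
      rest = costFoldl (λ s xs → suc (cost F pairBody (xs ∷ s ∷ ρ)))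
                (λ s xs → eval F pairBody (xs ∷ s ∷ ρ)) (false , run mergeₚ (xs , ys) ∷ zss) xss

      lengths : length (xs ++ ys ++ concat xss) ≡ length xs + length ys + length (concat xss)
      lengths = trans (Listₚ.length-++ xs)
        (trans (cong (length xs +_) (Listₚ.length-++ ys)) (sym (ℕₚ.+-assoc (length xs) _ _)))

      bound₂ : ∀ s m k l → suc (s * 1) + (suc (s * suc m) + (k + l) * suc s) ≤
                           (2 + k + (m + l)) * suc s
      bound₂ s m k l = ℕₚ.≤-trans (ℕₚ.m≤m+n _ m) (ℕₚ.≤-reflexive (eq s m k l))
        where
        eq : ∀ s m k l → suc (s * 1) + (suc (s * suc m) + (k + l) * suc s) + m ≡
                         (2 + k + (m + l)) * suc s
        eq = solve-∀

    cost-mergePairs : ∀ xss →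
      tick mergePairsₚ xss ≤ 6 + (length xss + length (concat xss)) * mergeFactor
    cost-mergePairs xss = ℕₚ.+-monoʳ-≤ 6 (cost-pairSteps (xss ∷ []) xss [])

    concat-ʳ++ : ∀ {A : Set} (xss yss : List (List A)) →
                 concat (xss ʳ++ yss) ↭ concat xss ++ concat yss
    concat-ʳ++ []         yss = ↭-refl
    concat-ʳ++ (xs ∷ xss) yss = begin
      concat (xss ʳ++ (xs ∷ yss))        ↭⟨ concat-ʳ++ xss (xs ∷ yss) ⟩
      concat xss ++ xs ++ concat yss     ↭⟨ Perm.shifts (concat xss) xs ⟩
      xs ++ concat xss ++ concat yss     ≡⟨ Listₚ.++-assoc xs (concat xss) (concat yss) ⟨
      (xs ++ concat xss) ++ concat yss   ∎
      where open PermutationReasoning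

    length-mergePairs : ∀ xss → length (mergePairs xss) ≡ ⌈ length xss /2⌉
    length-mergePairs []              = refl
    length-mergePairs (xs ∷ [])       = refl
    length-mergePairs (xs ∷ ys ∷ xss) = cong suc (length-mergePairs xss)

    length-round : ∀ xss → length (run roundₚ xss) ≡ ⌈ length xss /2⌉
    length-round []              = refl
    length-round (xs ∷ [])       = refl
    length-round (xs ∷ ys ∷ xss) = begin
      length (run roundₚ (xs ∷ ys ∷ xss)) ≡⟨ cong length (eval-mergePairs (xs ∷ ys ∷ xss)) ⟩
      length (reverse (mergePairs (xs ∷ ys ∷ xss)))
        ≡⟨ Listₚ.length-reverse (mergePairs (xs ∷ ys ∷ xss)) ⟩
      length (mergePairs (xs ∷ ys ∷ xss)) ≡⟨ length-mergePairs (xs ∷ ys ∷ xss) ⟩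
      ⌈ length (xs ∷ ys ∷ xss) /2⌉        ∎
      where open ≡-Reasoning

    round-↭ : ∀ xss → concat (run roundₚ xss) ↭ concat xss
    round-↭ []              = ↭-refl
    round-↭ (xs ∷ [])       = ↭-refl
    round-↭ (xs ∷ ys ∷ xss) = begin
      concat (run roundₚ (xs ∷ ys ∷ xss))
        ≡⟨ cong concat (eval-mergePairs (xs ∷ ys ∷ xss)) ⟩
      concat (reverse (mergePairs (xs ∷ ys ∷ xss)))
        ↭⟨ concat-ʳ++ (mergePairs (xs ∷ ys ∷ xss)) [] ⟩
      concat (mergePairs (xs ∷ ys ∷ xss)) ++ []     ≡⟨ Listₚ.++-identityʳ _ ⟩
      concat (mergePairs (xs ∷ ys ∷ xss))           ↭⟨ mergePairs-↭ (xs ∷ ys ∷ xss) ⟩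
      concat (xs ∷ ys ∷ xss)                        ∎
      where open PermutationReasoning

    round-↗ : ∀ {xss} → All Sorted xss → All Sorted (run roundₚ xss)
    round-↗ []                       = []
    round-↗ (xs↗ ∷ [])               = xs↗ ∷ []
    round-↗ {xs ∷ ys ∷ xss} (xs↗ ∷ ys↗ ∷ xss↗) =
      subst (All Sorted) (sym (eval-mergePairs (xs ∷ ys ∷ xss)))
        (Perm.All-resp-↭ (↭-sym (Perm.↭-reverse (mergePairs (xs ∷ ys ∷ xss))))
          (mergePairs-↗ (xs↗ ∷ ys↗ ∷ xss↗)))

    rounds-↭ : ∀ k xss → concat (iterate (run roundₚ) xss k) ↭ concat xss
    rounds-↭ zero    xss = ↭-refl
    rounds-↭ (suc k) xss = ↭-trans (rounds-↭ k (run roundₚ xss)) (round-↭ xss)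

    rounds-↗ : ∀ k {xss} → All Sorted xss → All Sorted (iterate (run roundₚ) xss k)
    rounds-↗ zero    xss↗ = xss↗
    rounds-↗ (suc k) xss↗ = rounds-↗ k (round-↗ xss↗)

    -- For correctness it is enough that a round removes at least one list while there are two or
    -- more.
    length-rounds : ∀ k xss → length xss ≤ suc k → length (iterate (run roundₚ) xss k) ≤ 1
    length-rounds zero    xss l≤ = l≤
    length-rounds (suc k) xss l≤ = length-rounds k (run roundₚ xss)
      (subst (_≤ suc k) (sym (length-round xss)) (half (length xss) l≤))
      where
      half : ∀ l → l ≤ suc (suc k) → ⌈ l /2⌉ ≤ suc k
      half l l≤ = ℕₚ.≤-trans (ℕₚ.⌈n/2⌉-mono l≤) (s≤s (ℕₚ.⌈n/2⌉≤n k))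

    -- A round that merges halves the number of lists and so lowers its logarithm by one, at a cost
    -- linear in the items; a round on at most one list falls under the 15. The hypothesis lets
    -- lists be charged as items: it holds for singletons and survives every round.
    cost-rounds : ∀ {Γ} (ρ : Env F Γ) k xss → length xss ≤ length (concat xss) →
      costIterate (λ yss → suc (cost F (call roundₚ #0) (yss ∷ ρ)))
                  (λ yss → eval F (call roundₚ #0) (yss ∷ ρ)) xss k ≤
      k * 15 + ⌈log₂ length xss ⌉ * ((length (concat xss) + length (concat xss)) * mergeFactor)
    cost-rounds ρ zero    xss l≤ = z≤n
    cost-rounds ρ (suc k) []  l≤ =
      ℕₚ.+-mono-≤ (ℕₚ.m≤m+n 6 9) (cost-rounds ρ k (run roundₚ []) l≤)
    cost-rounds ρ (suc k) (xs ∷ []) l≤ =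
      ℕₚ.+-mono-≤ (ℕₚ.m≤m+n 8 7) (cost-rounds ρ k (xs ∷ []) l≤)
    cost-rounds ρ (suc k) xss@(xs ∷ ys ∷ xss′) l≤ = begin
      9 + tick mergePairsₚ xss + rest
        ≤⟨ ℕₚ.+-mono-≤ (ℕₚ.+-monoʳ-≤ 9 first) (cost-rounds ρ k (run roundₚ xss) l≤′) ⟩
      9 + (6 + M) + (k * 15 + ⌈log₂ length (run roundₚ xss) ⌉ *
        ((length (concat (run roundₚ xss)) + length (concat (run roundₚ xss))) * mergeFactor))
        ≡⟨ cong₂ (λ l c → 9 + (6 + M) + (k * 15 + l * ((c + c) * mergeFactor))) log-length total ⟩
      9 + (6 + M) + (k * 15 + (⌈log₂ length xss ⌉ ∸ 1) * M)
        ≡⟨ eq k (⌈log₂ length xss ⌉ ∸ 1) M ⟩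
      suc k * 15 + suc (⌈log₂ length xss ⌉ ∸ 1) * M
        -- Two lists or more have a positive logarithm, so the truncated subtraction loses nothing.
        ≡⟨ cong (λ l → suc k * 15 + l * M) (ℕₚ.m+[n∸m]≡n (⌈log₂⌉-mono-≤ {2} {length xss} (s≤s (s≤s z≤n)))) ⟩
      suc k * 15 + ⌈log₂ length xss ⌉ * M ∎
      where
      open ℕₚ.≤-Reasoning
      M = (length (concat xss) + length (concat xss)) * mergeFactor
      rest = costIterate (λ yss → suc (cost F (call roundₚ #0) (yss ∷ ρ)))
                  (λ yss → eval F (call roundₚ #0) (yss ∷ ρ)) (run roundₚ xss) k

      total : length (concat (run roundₚ xss)) ≡ length (concat xss)
      total = Perm.↭-length (round-↭ xss)

      log-length : ⌈log₂ length (run roundₚ xss) ⌉ ≡ ⌈log₂ length xss ⌉ ∸ 1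
      log-length = trans (cong ⌈log₂_⌉ (length-round xss)) (⌈log₂⌈n/2⌉⌉≡⌈log₂n⌉∸1 (length xss))

      l≤′ : length (run roundₚ xss) ≤ length (concat (run roundₚ xss))
      l≤′ = begin
        length (run roundₚ xss)          ≡⟨ length-round xss ⟩
        ⌈ length xss /2⌉                 ≤⟨ ℕₚ.⌈n/2⌉≤n (length xss) ⟩
        length xss                       ≤⟨ l≤ ⟩
        length (concat xss)              ≡⟨ total ⟨
        length (concat (run roundₚ xss)) ∎

      first : tick mergePairsₚ xss ≤ 6 + M
      first = ℕₚ.≤-trans (cost-mergePairs xss)
        (ℕₚ.+-monoʳ-≤ 6 (ℕₚ.*-monoˡ-≤ mergeFactor (ℕₚ.+-monoˡ-≤ _ l≤)))

      eq : ∀ k l M → 9 + (6 + M) + (k * 15 + l * M) ≡ suc k * 15 + suc l * M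
      eq = solve-∀

    singles : ∀ (xs : List (V Item)) xss →
              foldl (λ yss y → [ y ] ∷ yss) xss xs ≡ map [_] xs ʳ++ xss
    singles []       xss = refl
    singles (x ∷ xs) xss = singles xs ([ x ] ∷ xss)

    private
      initial : List (V Item) → List (List (V Item))
      initial xs = foldl (λ yss y → [ y ] ∷ yss) [] xs

      env : List (V Item) → Env F (list Item ∷ [])
      env xs = xs ∷ []

      rounds : List (V Item) → ℕ
      rounds xs = run (lengthₚ {Item}) xs

      final : List (V Item) → List (List (V Item))
      final xs = iterate (run roundₚ) (initial xs) (rounds xs)

      initial-↭ : ∀ xs → concat (initial xs) ↭ xs
      initial-↭ xs = begin
        concat (initial xs)            ≡⟨ cong concat (singles xs []) ⟩
        concat (reverse (map [_] xs))  ↭⟨ concat-ʳ++ (map [_] xs) [] ⟩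
        concat (map [_] xs) ++ []      ≡⟨ Listₚ.++-identityʳ _ ⟩
        concat (map [_] xs)            ≡⟨ Listₚ.concat-map-[ xs ] ⟩
        xs                             ∎
        where open PermutationReasoning

      initial-↗ : ∀ xs → All Sorted (initial xs)
      initial-↗ xs = subst (All Sorted) (sym (singles xs []))
        (Perm.All-resp-↭ (↭-sym (Perm.↭-reverse (map [_] xs)))
          (Allₚ.map⁺ (All.universal (λ _ → [-]) xs)))

      length-initial : ∀ xs → length (initial xs) ≡ length xs
      length-initial xs = begin
        length (initial xs)           ≡⟨ cong length (singles xs []) ⟩
        length (reverse (map [_] xs)) ≡⟨ Listₚ.length-reverse (map [_] xs) ⟩
        length (map [_] xs)           ≡⟨ Listₚ.length-map [_] xs ⟩
        length xs                     ∎
        where open ≡-Reasoning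

      collapse : ∀ {Γ} (ρ : Env F Γ) xss → length xss ≤ 1 → All Sorted xss →
        let ys = evalCaseList F nil (#0 {A = list Item}) ρ xss in ys ↭ concat xss × Sorted ys
      collapse ρ []          _        _         = ↭-refl , []
      collapse ρ (ys ∷ [])   _        (ys↗ ∷ _) = ↭-sym (Perm.++-identityʳ ys) , ys↗
      collapse ρ (_ ∷ _ ∷ _) (s≤s ()) _

      cost-collapse : ∀ {Γ} (ρ : Env F Γ) xss →
        costCaseList F nil (#0 {A = list Item}) ρ xss ≤ 1
      cost-collapse ρ []       = s≤s z≤n
      cost-collapse ρ (_ ∷ _)  = s≤s z≤n

    eval-sort : ∀ xs → run sortₚ xs ↭ xs × Sorted (run sortₚ xs)
    eval-sort xs =
      ↭-trans (proj₁ collapsed) (↭-trans (rounds-↭ (rounds xs) (initial xs)) (initial-↭ xs)) ,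
      proj₂ collapsed
      where
      rounds-enough : length (initial xs) ≤ suc (rounds xs)
      rounds-enough = begin
        length (initial xs)   ≡⟨ length-initial xs ⟩
        length xs             ≡⟨ foldl-count 0 xs ⟨
        rounds xs             ≤⟨ ℕₚ.n≤1+n _ ⟩
        suc (rounds xs)       ∎
        where open ℕₚ.≤-Reasoning

      collapsed : run sortₚ xs ↭ concat (final xs) × Sorted (run sortₚ xs)
      collapsed = collapse (env xs) (final xs)
        (length-rounds (rounds xs) (initial xs) rounds-enough)
        (rounds-↗ (rounds xs) (initial-↗ xs))

    cost-sort : ∀ xs →
      tick sortₚ xs ≤
      linearFactor * suc (length xs) + ⌈log₂ length xs ⌉ * ((length xs + length xs) * mergeFactor)
    cost-sort xs = begin
      tick sortₚ xs
        ≤⟨ s≤s (ℕₚ.+-mono-≤ (s≤s (ℕₚ.+-mono-≤ (ℕₚ.+-mono-≤ countCost initialCost)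
             (cost-rounds (env xs) (rounds xs) (initial xs) (ℕₚ.≤-reflexive (trans (length-initial xs) (sym total))))))
             (cost-collapse (env xs) (final xs))) ⟩
      bound (rounds xs) (length (initial xs)) (length (concat (initial xs)))
        ≡⟨ cong (λ k → bound k (length (initial xs)) (length (concat (initial xs)))) (foldl-count 0 xs) ⟩
      bound m (length (initial xs)) (length (concat (initial xs)))
        ≡⟨ cong₂ (bound m) (length-initial xs) total ⟩
      bound m m m
        ≤⟨ collect (size countₜ) (size initialₜ) m (⌈log₂ m ⌉ * ((m + m) * mergeFactor)) ⟩
      linearFactor * suc m + ⌈log₂ m ⌉ * ((m + m) * mergeFactor) ∎
      where
      open ℕₚ.≤-Reasoning
      m = length xs

      bound : ℕ → ℕ → ℕ → ℕ
      bound k l c = suc (suc (size countₜ * suc m + size initialₜ * suc m +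
        (k * 15 + ⌈log₂ l ⌉ * ((c + c) * mergeFactor))) + 1)

      total : length (concat (initial xs)) ≡ m
      total = Perm.↭-length (initial-↭ xs)

      countCost : cost F countₜ (xs ∷ []) ≤ size countₜ * suc m
      countCost = cost≤ F m countₜ (xs ∷ []) (_ , _ , _ , _ , ℕₚ.≤-refl)

      initialCost : cost F initialₜ (xs ∷ []) ≤ size initialₜ * suc m
      initialCost = cost≤ F m initialₜ (xs ∷ []) (_ , _ , _ , ℕₚ.≤-refl)

      collect : ∀ a b m l →
        suc (suc (a * suc m + b * suc m + (m * 15 + l)) + 1) ≤ (a + b + 18) * suc m + l
      collect a b m l = ℕₚ.≤-trans (ℕₚ.m≤m+n _ (15 + 3 * m)) (ℕₚ.≤-reflexive (eq a b m l))
        where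
        eq : ∀ a b m l →
          suc (suc (a * suc m + b * suc m + (m * 15 + l)) + 1) + (15 + 3 * m) ≡ (a + b + 18) * suc m + l
        eq = solve-∀

open MergeSort

-- Finite subsets

fromList : ∀ {n} → List (Fin n) → Subset n
fromList = foldr (λ i p → ⁅ i ⁆ ∪ p) ∅

∈-fromList⁺ : ∀ {n} {i : Fin n} is → i List.∈ is → i ∈ fromList is
∈-fromList⁺ {i = i} (_ ∷ _) (here ≡.refl) = Subsetₚ.x∈p∪q⁺ (inj₁ (Subsetₚ.x∈⁅x⁆ i))
∈-fromList⁺ (_ ∷ is) (there i∈is) = Subsetₚ.x∈p∪q⁺ (inj₂ (∈-fromList⁺ is i∈is))

∈-fromList⁻ : ∀ {n} {i : Fin n} is → i ∈ fromList is → i List.∈ is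
∈-fromList⁻ []       i∈ = ⊥-elim (Subsetₚ.∉⊥ i∈)
∈-fromList⁻ (j ∷ js) i∈ with Subsetₚ.x∈p∪q⁻ ⁅ j ⁆ (fromList js) i∈
... | inj₁ i∈⁅j⁆ = here (Subsetₚ.x∈⁅y⁆⇒x≡y j i∈⁅j⁆)
... | inj₂ i∈js  = there (∈-fromList⁻ js i∈js)

∣⁅i⁆∪p∣≤1+∣p∣ : ∀ {n} (i : Fin n) p → ∣ ⁅ i ⁆ ∪ p ∣ ℕ.≤ suc ∣ p ∣
∣⁅i⁆∪p∣≤1+∣p∣ zero    (inside  ∷ p) =
  ℕₚ.≤-trans (ℕₚ.≤-reflexive (cong (suc ∘ ∣_∣) (Subsetₚ.∪-identityˡ p))) (ℕₚ.n≤1+n _)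
∣⁅i⁆∪p∣≤1+∣p∣ zero    (outside ∷ p) = ℕₚ.≤-reflexive (cong (suc ∘ ∣_∣) (Subsetₚ.∪-identityˡ p))
∣⁅i⁆∪p∣≤1+∣p∣ (suc i) (inside  ∷ p) = s≤s (∣⁅i⁆∪p∣≤1+∣p∣ i p)
∣⁅i⁆∪p∣≤1+∣p∣ (suc i) (outside ∷ p) = ∣⁅i⁆∪p∣≤1+∣p∣ i p

i∉p⇒∣⁅i⁆∪p∣≡1+∣p∣ : ∀ {n} (i : Fin n) p → i ∉ p → ∣ ⁅ i ⁆ ∪ p ∣ ≡ suc ∣ p ∣
i∉p⇒∣⁅i⁆∪p∣≡1+∣p∣ zero    (inside  ∷ p) i∉ = contradiction Vec.here i∉
i∉p⇒∣⁅i⁆∪p∣≡1+∣p∣ zero    (outside ∷ p) i∉ = cong (suc ∘ ∣_∣) (Subsetₚ.∪-identityˡ p)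
i∉p⇒∣⁅i⁆∪p∣≡1+∣p∣ (suc i) (inside  ∷ p) i∉ = cong suc (i∉p⇒∣⁅i⁆∪p∣≡1+∣p∣ i p (i∉ ∘ Vec.there))
i∉p⇒∣⁅i⁆∪p∣≡1+∣p∣ (suc i) (outside ∷ p) i∉ = i∉p⇒∣⁅i⁆∪p∣≡1+∣p∣ i p (i∉ ∘ Vec.there)

∣fromList∣≤length : ∀ {n} (is : List (Fin n)) → ∣ fromList is ∣ ℕ.≤ length is
∣fromList∣≤length {n} []       = ℕₚ.≤-reflexive (Subsetₚ.∣⊥∣≡0 n)
∣fromList∣≤length (i ∷ is) = ℕₚ.≤-trans (∣⁅i⁆∪p∣≤1+∣p∣ i _) (s≤s (∣fromList∣≤length is))

∣fromList∣≡length : ∀ {n} {is : List (Fin n)} → Unique is → ∣ fromList is ∣ ≡ length is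
∣fromList∣≡length {n} []      = Subsetₚ.∣⊥∣≡0 n
∣fromList∣≡length {is = i ∷ is} (i∉is ∷ u) =
  ≡.trans (i∉p⇒∣⁅i⁆∪p∣≡1+∣p∣ i _ (λ i∈ → Allₚ.All¬⇒¬Any i∉is (∈-fromList⁻ is i∈)))
          (cong suc (∣fromList∣≡length u))

∣p∪q∣≡∣p∣+∣q─p∣ : ∀ {n} (p q : Subset n) → ∣ p ∪ q ∣ ≡ ∣ p ∣ ℕ.+ ∣ q ─ p ∣
∣p∪q∣≡∣p∣+∣q─p∣ []            []            = ≡.refl
∣p∪q∣≡∣p∣+∣q─p∣ (outside ∷ p) (outside ∷ q) = ∣p∪q∣≡∣p∣+∣q─p∣ p q
∣p∪q∣≡∣p∣+∣q─p∣ (outside ∷ p) (inside  ∷ q) =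
  ≡.trans (cong suc (∣p∪q∣≡∣p∣+∣q─p∣ p q)) (≡.sym (ℕₚ.+-suc ∣ p ∣ _))
∣p∪q∣≡∣p∣+∣q─p∣ (inside  ∷ p) (outside ∷ q) = cong suc (∣p∪q∣≡∣p∣+∣q─p∣ p q)
∣p∪q∣≡∣p∣+∣q─p∣ (inside  ∷ p) (inside  ∷ q) = cong suc (∣p∪q∣≡∣p∣+∣q─p∣ p q)

-- Ordered fields

module _ (F : OrderedField) where
  open OrderedField F
  open RawMonoidDefinitions +-rawMonoid using () renaming (_×_ to _·_)

  poset : Poset _ _ _
  poset = record { isPartialOrder = record { isPreorder = record
    { isEquivalence =
      isEquivalence ; reflexive = ≤-reflexive ; trans = ≤-trans } ; antisym = antisym } }

  open PartialOrderReasoning poset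
  open AbelianGroupₚ +-abelianGroup using (xyx⁻¹≈y; ε⁻¹≈ε; ⁻¹-involutive)

  +-mono-≤ : ∀ {a b x y} → a ≤ b → x ≤ y → a + x ≤ b + y
  +-mono-≤ {a} {b} {x} {y} a≤b x≤y = begin
    a + x ≤⟨ +-monoˡ-≤ x a≤b ⟩
    b + x ≈⟨ +-comm b x ⟩
    x + b ≤⟨ +-monoˡ-≤ b x≤y ⟩
    y + b ≈⟨ +-comm y b ⟩
    b + y ∎

  +-nonNegative : ∀ {x y} → 0# ≤ x → 0# ≤ y → 0# ≤ x + y
  +-nonNegative {x} {y} 0≤x 0≤y = begin
    0#      ≈⟨ +-identityˡ 0# ⟨
    0# + 0# ≤⟨ +-mono-≤ 0≤x 0≤y ⟩
    x + y   ∎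

  x≤x+y : ∀ x {y} → 0# ≤ y → x ≤ x + y
  x≤x+y x {y} 0≤y = begin
    x      ≈⟨ +-identityʳ x ⟨
    x + 0# ≤⟨ +-mono-≤ ≤-refl 0≤y ⟩
    x + y  ∎

  y≤x+y : ∀ {x} y → 0# ≤ x → y ≤ x + y
  y≤x+y {x} y 0≤x = ≤-trans (x≤x+y y 0≤x) (≤-reflexive (+-comm y x))

  x-y+y≈x : ∀ x y → (x - y) + y ≈ x
  x-y+y≈x x y = begin-equality
    (x - y) + y   ≈⟨ +-assoc x (- y) y ⟩
    x + (- y + y) ≈⟨ +-congˡ (-‿inverseˡ y) ⟩
    x + 0#        ≈⟨ +-identityʳ x ⟩
    x             ∎

  x-0≈x : ∀ x → x - 0# ≈ x
  x-0≈x x = trans (+-congˡ ε⁻¹≈ε) (+-identityʳ x)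

  x-y≤z⇒x≤z+y : ∀ {x y z} → x - y ≤ z → x ≤ z + y
  x-y≤z⇒x≤z+y {x} {y} {z} p = begin
    x           ≈⟨ x-y+y≈x x y ⟨
    (x - y) + y ≤⟨ +-monoˡ-≤ y p ⟩
    z + y       ∎

  x≤y+z⇒x-y≤z : ∀ {x y z} → x ≤ y + z → x - y ≤ z
  x≤y+z⇒x-y≤z {x} {y} {z} p = begin
    x - y       ≤⟨ +-monoˡ-≤ (- y) p ⟩
    (y + z) - y ≈⟨ xyx⁻¹≈y y z ⟩
    z           ∎

  x≤y⇒0≤y-x : ∀ {x y} → x ≤ y → 0# ≤ y - x
  x≤y⇒0≤y-x {x} {y} p = begin
    0#    ≈⟨ -‿inverseʳ x ⟨
    x - x ≤⟨ +-monoˡ-≤ (- x) p ⟩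
    y - x ∎

  *-monoʳ-≤ : ∀ {x y z} → 0# ≤ x → y ≤ z → x * y ≤ x * z
  *-monoʳ-≤ {x} {y} {z} 0≤x y≤z = begin
    x * y               ≤⟨ y≤x+y (x * y) (*-nonNegative 0≤x (x≤y⇒0≤y-x y≤z)) ⟩
    x * (z - y) + x * y ≈⟨ distribˡ x (z - y) y ⟨
    x * ((z - y) + y)   ≈⟨ *-congˡ (x-y+y≈x z y) ⟩
    x * z               ∎

  0≤1 : 0# ≤ 1#
  0≤1 with total 0# 1#
  ... | inj₁ 0≤1 = 0≤1
  ... | inj₂ 1≤0 = begin
    0#          ≤⟨ *-nonNegative 0≤-1 0≤-1 ⟩
    - 1# * - 1# ≈⟨ -1*x≈-x (- 1#) ⟩
    - (- 1#)    ≈⟨ ⁻¹-involutive 1# ⟩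
    1#          ∎
    where
    open Ringₚ ring using (-1*x≈-x)
    0≤-1 : 0# ≤ - 1#
    0≤-1 = ≤-trans (x≤y⇒0≤y-x 1≤0) (≤-reflexive (+-identityˡ (- 1#)))

  -- Makes `B + 1#` work as an infinite key: the budget `B` can never pay for it.
  x+1≰x : ∀ x → ¬ (x + 1# ≤ x)
  x+1≰x x p = 0≉1 (antisym 0≤1 (begin
    1#            ≈⟨ xyx⁻¹≈y x 1# ⟨
    (x + 1#) - x  ≤⟨ +-monoˡ-≤ (- x) p ⟩
    x - x         ≈⟨ -‿inverseʳ x ⟩
    0#            ∎))

  ·-monoˡ-≤ : ∀ {x} → 0# ≤ x → ∀ {k l} → k ℕ.≤ l → k · x ≤ l · x
  ·-monoˡ-≤ 0≤x {l = zero}  z≤n = ≤-refl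
  ·-monoˡ-≤ 0≤x {l = suc l} z≤n = +-nonNegative 0≤x (·-monoˡ-≤ 0≤x {0} {l} z≤n)
  ·-monoˡ-≤ 0≤x (s≤s k≤l)       = +-mono-≤ ≤-refl (·-monoˡ-≤ 0≤x k≤l)

  sumOver : ∀ {A : Set} → (A → Carrier) → List A → Carrier
  sumOver f = foldr (λ a x → f a + x) 0#

  sumOver-nonNegative : ∀ {A : Set} {f : A → Carrier} → (∀ a → 0# ≤ f a) →
                        ∀ as → 0# ≤ sumOver f as
  sumOver-nonNegative 0≤f []       = ≤-refl
  sumOver-nonNegative 0≤f (a ∷ as) = +-nonNegative (0≤f a) (sumOver-nonNegative 0≤f as)

  sumOver-++ : ∀ {A : Set} (f : A → Carrier) as bs →
               sumOver f (as ++ bs) ≈ sumOver f as + sumOver f bs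
  sumOver-++ f []       bs = sym (+-identityˡ _)
  sumOver-++ f (a ∷ as) bs = trans (+-congˡ (sumOver-++ f as bs)) (sym (+-assoc _ _ _))

  sumOver-cong : ∀ {A : Set} {f g : A → Carrier} {as} →
                 All (λ a → f a ≈ g a) as → sumOver f as ≈ sumOver g as
  sumOver-cong []         = refl
  sumOver-cong (eq ∷ eqs) = +-cong eq (sumOver-cong eqs)

  sumOver-zero : ∀ {A : Set} {f : A → Carrier} {as} →
                 All (λ a → f a ≈ 0#) as → sumOver f as ≈ 0#
  sumOver-zero []         = refl
  sumOver-zero (eq ∷ eqs) = trans (+-cong eq (sumOver-zero eqs)) (+-identityˡ 0#)

  sumOver-↭ : ∀ {A : Set} (f : A → Carrier) {as bs} → as ↭ bs → sumOver f as ≈ sumOver f bs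
  sumOver-↭ f _↭_.refl         = refl
  sumOver-↭ f (_↭_.prep a p)       = +-congˡ (sumOver-↭ f p)
  sumOver-↭ f (_↭_.swap {as} {bs} a b p) = begin-equality
    f a + (f b + sumOver f as) ≈⟨ +-congˡ (+-congˡ (sumOver-↭ f p)) ⟩
    f a + (f b + sumOver f bs) ≈⟨ +-assoc _ _ _ ⟨
    f a + f b + sumOver f bs   ≈⟨ +-congʳ (+-comm _ _) ⟩
    f b + f a + sumOver f bs   ≈⟨ +-assoc _ _ _ ⟩
    f b + (f a + sumOver f bs) ∎
  sumOver-↭ f (_↭_.trans p q)  = trans (sumOver-↭ f p) (sumOver-↭ f q)

  sumOver-tabulate : ∀ {n} {A : Set} (f : A → Carrier) (g : Fin n → A) →
                     sumOver f (tabulate g) ≡ sum (f ∘ g)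
  sumOver-tabulate {zero}  f g = ≡.refl
  sumOver-tabulate {suc n} f g = cong (f (g zero) +_) (sumOver-tabulate f (g ∘ suc))

  -- This is where uniform weights enter: the objective becomes a multiple of the number of covered
  -- nodes, and solutions can be compared by counting.
  sum-indicator : ∀ {n} {w : Fin n → Carrier} {w₀} → (∀ i → w i ≈ w₀) → ∀ C →
                  sum (λ i → if lookup C i then w i else 0#) ≈ ∣ C ∣ · w₀
  sum-indicator w≈w₀ []            = refl
  sum-indicator w≈w₀ (inside  ∷ C) = +-cong (w≈w₀ zero) (sum-indicator (w≈w₀ ∘ suc) C)
  sum-indicator w≈w₀ (outside ∷ C) = trans (+-identityˡ _) (sum-indicator (w≈w₀ ∘ suc) C)

  -- Sums of the smallest keys of a sorted list

  module _ {A : Set} (key : A → Carrier) where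

    private
      _⊑_ : A → A → Set
      a ⊑ b = key a ≤ key b

    -- Each entry of a sorted list is at most its successor. The bound on `r` keeps the shifted
    -- prefix from being shorter than the original one.
    sum-take-tail : ∀ {a as} r → Linked _⊑_ (a ∷ as) → r ℕ.≤ length as →
                    sumOver key (take r (a ∷ as)) ≤ sumOver key (take r as)
    sum-take-tail zero    _                   _       = ≤-refl
    sum-take-tail (suc r) (a⊑b ∷ as↗) (s≤s r≤) = +-mono-≤ a⊑b (sum-take-tail r as↗ r≤)

    -- Lets the `r` smallest keys bound the spending `f` of any rival that satisfies `T` at `r`
    -- places or more. An element of `T` is matched with the first remaining key; at any other
    -- element the prefix is shifted by `sum-take-tail`.
    sum-take-least : ∀ {f : A → Carrier} {T : Pred A 0ℓ} (T? : Decidable T) →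
      (∀ a → 0# ≤ f a) → (∀ a → T a → key a ≤ f a) →
      ∀ r {as} → Linked _⊑_ as → r ℕ.≤ length (filter T? as) →
      sumOver key (take r as) ≤ sumOver f as
    sum-take-least T? 0≤f key≤f zero    {as}     _   _  = sumOver-nonNegative 0≤f as
    sum-take-least T? 0≤f key≤f (suc r) {a ∷ as} as↗ r≤ with T? a
    ... | yes Ta = +-mono-≤ (key≤f a Ta)
                     (sum-take-least T? 0≤f key≤f r (Linked.tail as↗) (ℕₚ.≤-pred r≤))
    ... | no  _  = ≤-trans
      (sum-take-tail (suc r) as↗ (ℕₚ.≤-trans r≤ (Listₚ.length-filter T? as)))
      (≤-trans (sum-take-least T? 0≤f key≤f (suc r) (Linked.tail as↗) r≤) (y≤x+y _ (0≤f a)))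

-- Coverage in a star

module Star {F : OrderedField} (I : Instance F) {v₀ : Fin (Instance.n I)}
            (star : IsStarWithCentre I v₀) where
  open OrderedField F
  open Instance I

  satellite : Fin m → Fin n
  satellite e = proj₁ (proj₁ star e)

  satellite≢v₀ : ∀ e → satellite e ≢ v₀
  satellite≢v₀ e = proj₁ (proj₂ (proj₁ star e))

  joins : ∀ e → Joins e v₀ (satellite e)
  joins e = proj₂ (proj₂ (proj₁ star e))

  satellite-injective : ∀ {e f} → satellite e ≡ satellite f → e ≡ f
  satellite-injective {e} {f} eq = simple (joins e) (subst (Joins f v₀) (≡.sym eq) (joins f))

  Joins-ends : ∀ {e i j} → Joins e i j →
               (i ≡ v₀ × j ≡ satellite e) ⊎ (i ≡ satellite e × j ≡ v₀)
  Joins-ends {e} J with joins e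
  Joins-ends {e} (inj₁ p) | inj₁ q with ≡.refl ← ≡.trans (≡.sym p) q = inj₁ (≡.refl , ≡.refl)
  Joins-ends {e} (inj₁ p) | inj₂ q with ≡.refl ← ≡.trans (≡.sym p) q = inj₂ (≡.refl , ≡.refl)
  Joins-ends {e} (inj₂ p) | inj₁ q with ≡.refl ← ≡.trans (≡.sym p) q = inj₂ (≡.refl , ≡.refl)
  Joins-ends {e} (inj₂ p) | inj₂ q with ≡.refl ← ≡.trans (≡.sym p) q = inj₁ (≡.refl , ≡.refl)

  satellite-surjective : ∀ {i} → i ≢ v₀ → ∃[ e ] satellite e ≡ i
  satellite-surjective {i} i≢v₀ with proj₂ star i i≢v₀
  ... | e , J with Joins-ends J
  ...   | inj₁ (_ , eq)     = e , ≡.sym eq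
  ...   | inj₂ (_ , i≡v₀)  = contradiction i≡v₀ i≢v₀

  module _ (δ : Fin m → Carrier) (δ-bounds : ∀ e → 0# ≤ δ e × δ e ≤ u e) where

    Near : Fin m → Set
    Near e = ℓ e - δ e ≤ R

    near? : ∀ e → Dec (Near e)
    near? e = ℓ e - δ e ≤? R

    NearCentre : Fin n → Set
    NearCentre i = i ≡ v₀ ⊎ ∃[ e ] satellite e ≡ i × Near e

    nearCentre : List (Fin m) → Subset n
    nearCentre es = fromList (v₀ ∷ map satellite (filter near? es))

    nearCentre⁻ : ∀ es {i} → i ∈ nearCentre es → NearCentre i
    nearCentre⁻ es i∈ with ∈-fromList⁻ (v₀ ∷ map satellite (filter near? es)) i∈
    ... | here i≡v₀ = inj₁ i≡v₀
    ... | there i∈s with Memₚ.∈-map⁻ satellite i∈s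
    ...   | e , e∈ , i≡ = inj₂ (e , ≡.sym i≡ , proj₂ (Memₚ.∈-filter⁻ near? {xs = es} e∈))

    nearCentre⁺ : ∀ es → (∀ e → e List.∈ es) → ∀ {i} → NearCentre i → i ∈ nearCentre es
    nearCentre⁺ es all near = ∈-fromList⁺ (v₀ ∷ map satellite (filter near? es)) (member near)
      where
      member : ∀ {i} → NearCentre i → i List.∈ v₀ ∷ map satellite (filter near? es)
      member (inj₁ i≡v₀)                = here i≡v₀
      member (inj₂ (e , ≡.refl , near)) =
        there (Memₚ.∈-map⁺ satellite (Memₚ.∈-filter⁺ near? (all e) near))

    0≤edge : ∀ e → 0# ≤ ℓ e - δ e
    0≤edge e = x≤y⇒0≤y-x F (≤-trans (proj₂ (δ-bounds e)) (proj₁ (u<ℓ e)))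

    0≤walkLength : ∀ {i j} (π : Walk I i j) → 0# ≤ walkLength I δ π
    0≤walkLength stop         = ≤-refl
    0≤walkLength (step e _ π) = +-nonNegative F (0≤edge e) (0≤walkLength π)

    -- A satellite can be left only by its one edge, and the rest of the walk has non-negative
    -- length because `δ e ≤ u e < ℓ e`.
    first-edge : ∀ {i j} (π : Walk I i j) → i ≢ j → i ≢ v₀ →
                 ∃[ e ] satellite e ≡ i × ℓ e - δ e ≤ walkLength I δ π
    first-edge stop         i≢i  _    = contradiction ≡.refl i≢i
    first-edge (step e J π) _    i≢v₀ with Joins-ends J
    ... | inj₁ (i≡v₀ , _) = contradiction i≡v₀ i≢v₀
    ... | inj₂ (eq , _)   = e , ≡.sym eq , x≤x+y F _ (0≤walkLength π)

    last-edge : ∀ {i j} (π : Walk I i j) → i ≢ j → j ≢ v₀ →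
                ∃[ e ] satellite e ≡ j × ℓ e - δ e ≤ walkLength I δ π
    last-edge stop                       i≢i _    = contradiction ≡.refl i≢i
    last-edge {j = j} (step {j = k} e J π) _   j≢v₀ with k ≟ᶠ j
    ... | no k≢j     with last-edge π k≢j j≢v₀
    ...   | f , eq , f≤π = f , eq , ≤-trans f≤π (y≤x+y F _ (0≤edge e))
    last-edge (step e J π) _ j≢v₀ | yes ≡.refl with Joins-ends J
    ... | inj₁ (_ , eq)   = e , ≡.sym eq , x≤x+y F _ (0≤walkLength π)
    ... | inj₂ (_ , j≡v₀) = contradiction j≡v₀ j≢v₀

    covered⇒nearCentre : ∀ {X i} → Covered I X δ i → i ∈ X ⊎ NearCentre i
    covered⇒nearCentre {i = i} (j , j∈X , d , (((π , _) , π≈d) , _) , d≤R) with i ≟ᶠ j | i ≟ᶠ v₀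
    ... | yes ≡.refl | _        = inj₁ j∈X
    ... | no  _      | yes i≡v₀ = inj₂ (inj₁ i≡v₀)
    ... | no  i≢j    | no  i≢v₀ with first-edge π i≢j i≢v₀
    ...   | e , eq , e≤π = inj₂ (inj₂ (e , eq , ≤-trans e≤π (≤-trans (≤-reflexive π≈d) d≤R)))

    -- The walk that covers a node without a facility ends at the centre or arrives by the
    -- facility's own edge. So covering anything beyond `X` requires a facility near the centre, the
    -- one that makes up for the centre in `coverage-bound`.
    covered⇒nearFacility : ∀ {X i} → Covered I X δ i → i ∉ X → ∃[ j ] j ∈ X × NearCentre j
    covered⇒nearFacility {i = i} (j , j∈X , d , (((π , _) , π≈d) , _) , d≤R) i∉X with j ≟ᶠ v₀
    ... | yes j≡v₀ = j , j∈X , inj₁ j≡v₀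
    ... | no  j≢v₀ with last-edge π (λ { ≡.refl → i∉X j∈X }) j≢v₀
    ...   | e , eq , e≤π = j , j∈X , inj₂ (e , eq , ≤-trans e≤π (≤-trans (≤-reflexive π≈d) d≤R))

    nearCentre⇒covered : ∀ {X i} → v₀ ∈ X → i ∈ X ⊎ NearCentre i → Covered I X δ i
    nearCentre⇒covered {i = i} v₀∈X (inj₁ i∈X) =
      i , i∈X , 0# , (((stop , [] ∷ []) , refl) , λ π → 0≤walkLength (proj₁ π)) , proj₁ 0<R
    nearCentre⇒covered v₀∈X (inj₂ (inj₁ ≡.refl)) = nearCentre⇒covered v₀∈X (inj₁ v₀∈X)
    nearCentre⇒covered v₀∈X (inj₂ (inj₂ (e , ≡.refl , near))) =
      v₀ , v₀∈X , ℓ e - δ e ,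
      (((step e (Sum.swap (joins e)) stop , (satellite≢v₀ e ∷ []) ∷ [] ∷ []) , +-identityʳ _) , shortest) ,
      near
      where
      shortest : ∀ (π : Path I (satellite e) v₀) → ℓ e - δ e ≤ pathLength I δ π
      -- Every walk from a satellite to the centre begins with the satellite's only edge, so the
      -- direct path is a shortest one.
      shortest (π , _) with first-edge π (satellite≢v₀ e) (satellite≢v₀ e)
      ... | f , eq , f≤π with ≡.refl ← satellite-injective eq = f≤π

-- The algorithm

eqNat : ∀ {Γ} → Γ ⊢ nat → Γ ⊢ nat → Γ ⊢ bool
eqNat s t = if′ (leqNat s t) (leqNat t s) false′

-- The common node of the first two edges, or either end of a single edge.
centreₚ : list Edge ∷ [] ⊢ nat
centreₚ =
  caseList #0 zero′
    (caseList #1 (fst (fst #0))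
      (if′ (if′ (eqNat (fst (fst #2)) (fst (fst #0))) true′
                (eqNat (fst (fst #2)) (snd (fst #0))))
        (fst (fst #2))
        (snd (fst #2))))

-- A satellite that cannot be brought within the radius gets a key above
-- the budget.
itemₚ : (nat ⊗ num ⊗ num) ⊗ nat ⊗ Edge ∷ [] ⊢ Item
itemₚ = let′ need
  (pair (if′ (leq #0 (upper #1)) (arith mul (price #1) #0) (arith add (budget #1) 1′))
  (pair (fst (snd #1))
  (pair (if′ (eqNat (fst (ends #1)) (fst (fst #1))) (snd (ends #1)) (fst (ends #1)))
  #0)))
  where
  Args : Type
  Args = (nat ⊗ num ⊗ num) ⊗ nat ⊗ Edge

  radius budget len upper price : ∀ {Γ} → Γ ⊢ Args → Γ ⊢ num
  radius t = fst (snd (fst t))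
  budget t = snd (snd (fst t))
  len t    = fst (snd (snd (snd t)))
  upper t  = fst (snd (snd (snd (snd t))))
  price t  = snd (snd (snd (snd (snd t))))

  ends : ∀ {Γ} → Γ ⊢ Args → Γ ⊢ nat ⊗ nat
  ends t = fst (snd (snd t))

  need : Args ∷ [] ⊢ num
  need = if′ (leq (len #0) (radius #0)) 0′ (arith sub (len #0) (radius #0))

itemsₚ : (nat ⊗ num ⊗ num) ⊗ list Edge ∷ [] ⊢ list Item
itemsₚ = snd (foreach (snd #0) (pair zero′ nil)
  (pair (suc′ (fst #1))
        (cons (call itemₚ (pair (fst #2) (pair (fst #1) #0))) (snd #1))))

inputRadius inputBudget : ∀ {Γ} → Γ ⊢ Input → Γ ⊢ num
inputRadius t = fst (snd (snd t))
inputBudget t = fst (snd (snd (snd t)))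

inputEdges : ∀ {Γ} → Γ ⊢ Input → Γ ⊢ list Edge
inputEdges t = snd (snd (snd (snd (snd t))))

prepareₚ : Input ∷ [] ⊢ list Item
prepareₚ = call itemsₚ
  (pair (pair (call centreₚ (inputEdges #0)) (pair (inputRadius #0) (inputBudget #0)))
        (inputEdges #0))

-- The number of satellites still to be left without a facility, the
-- budget spent, the facilities, and the table of reductions.
SelectState : Type
SelectState = (nat ⊗ num) ⊗ Output

-- Items arrive by increasing key, so a countdown from `n ∸ p` leaves the dearest ones for the
-- facilities. An item that is refused still enters the table, with reduction zero, because the
-- table must list every edge.
selectₚ : num ⊗ Item ⊗ SelectState ∷ [] ⊢ SelectState
selectₚ =
  caseNat (fst (fst (state #0)))
    (pair (pair zero′ (spent #0))
          (pair (cons (satellite #0) (nodes #0)) (cons (pair (number #0) 0′) (table #0))))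
    (if′ (leq (arith add (spent #1) (key #1)) (fst #1))
      (pair (pair #0 (arith add (spent #1) (key #1)))
            (pair (nodes #1) (cons (pair (number #1) (need #1)) (table #1))))
      (pair (pair #0 (spent #1))
            (pair (nodes #1) (cons (pair (number #1) 0′) (table #1)))))
  where
  Args : Type
  Args = num ⊗ Item ⊗ SelectState

  key need spent : ∀ {Γ} → Γ ⊢ Args → Γ ⊢ num
  number satellite : ∀ {Γ} → Γ ⊢ Args → Γ ⊢ nat
  key t       = fst (fst (snd t))
  number t    = fst (snd (fst (snd t)))
  satellite t = fst (snd (snd (fst (snd t))))
  need t      = snd (snd (snd (fst (snd t))))

  state : ∀ {Γ} → Γ ⊢ Args → Γ ⊢ SelectState
  state t = snd (snd t)
  spent t = snd (fst (state t))

  nodes : ∀ {Γ} → Γ ⊢ Args → Γ ⊢ list nat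
  nodes t = fst (snd (state t))

  table : ∀ {Γ} → Γ ⊢ Args → Γ ⊢ list (nat ⊗ num)
  table t = snd (snd (state t))

-- Numbers of this type can only be decremented, so subtraction takes as many rounds as its second
-- argument, which will be `p` and thus at most `n`.
minusₚ : nat ⊗ nat ∷ [] ⊢ nat
minusₚ = for (snd #0) (fst #0) (caseNat #0 zero′ #0)

-- Of the `n - 1` satellites, the countdown from `n ∸ p` leaves `p - 1`, which together with the
-- centre makes `p` facilities. For `p = 0` the countdown does not reach zero and the centre must be
-- left out as well, hence the case distinction.
outputₚ : Input ⊗ list Item ∷ [] ⊢ Output
outputₚ = let′
  (snd (foreach (snd #0)
    (pair (pair (call minusₚ (pair (fst (fst #0)) (fst (snd (fst #0))))) 0′) (pair nil nil))
    (call selectₚ (pair (inputBudget (fst #2)) (pair #0 #1)))))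
  (caseNat (fst (snd (fst #1)))
    (pair nil (snd #0))
    (pair (cons (call centreₚ (inputEdges (fst #2))) (fst #1)) (snd #1)))

mainₚ : Program
mainₚ = call outputₚ (pair #0 (call sortₚ (call prepareₚ #0)))

-- Finding the centre

eqᵇ : ℕ → ℕ → Bool
eqᵇ a b = if a ≤ᵇ b then b ≤ᵇ a else false

≤ᵇ-refl : ∀ a → (a ≤ᵇ a) ≡ true
≤ᵇ-refl zero    = ≡.refl
≤ᵇ-refl (suc a) = ≤ᵇ-refl′ a
  where
  ≤ᵇ-refl′ : ∀ a → (a ℕ.<ᵇ suc a) ≡ true
  ≤ᵇ-refl′ zero    = ≡.refl
  ≤ᵇ-refl′ (suc a) = ≤ᵇ-refl′ a

eqᵇ-refl : ∀ a → eqᵇ a a ≡ true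
eqᵇ-refl a rewrite ≤ᵇ-refl a = ≡.refl

eqᵇ-≢ : ∀ {n} {i j : Fin n} → i ≢ j → eqᵇ (toℕ i) (toℕ j) ≡ false
eqᵇ-≢ {i = i} {j} i≢j
  with toℕ i ≤ᵇ toℕ j | toℕ j ≤ᵇ toℕ i | ℕₚ.≤ᵇ⇒≤ (toℕ i) (toℕ j) | ℕₚ.≤ᵇ⇒≤ (toℕ j) (toℕ i)
... | false | _     | _ | _ = ≡.refl
... | true  | false | _ | _ = ≡.refl
... | true  | true  | p | q = contradiction (Finₚ.toℕ-injective (ℕₚ.≤-antisym (p _) (q _))) i≢j

module _ (F : OrderedField) {n : ℕ} where

  private
    -- Stated for a bare map `ends`, since the number of edges has to be split into cases and in
    -- `Instance` it is a field.
    module Ends {m} (ends : Fin m → Fin n × Fin n) where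
      Joins : Fin m → Fin n → Fin n → Set
      Joins e i j = ends e ≡ (i , j) ⊎ ends e ≡ (j , i)

      IsCentre : Fin n → Set
      IsCentre v = (∀ e → ∃[ i ] i ≢ v × Joins e v i) × (∀ i → i ≢ v → ∃[ e ] Joins e v i)

    open Ends using (Joins; IsCentre)

  -- The conclusion names its own centre, because a single edge has two and the program may find the
  -- other one. Two edges of a star have only the centre in common, as the network is simple.
  eval-centre : ∀ {m} (ends : Fin m → Fin n × Fin n) (rest : Fin m → Val F (num ⊗ num ⊗ num)) →
    (∀ {e f i j} → Joins ends e i j → Joins ends f i j → e ≡ f) →
    ∃ (IsCentre ends) →
    ∃[ v ] IsCentre ends v ×
      eval F centreₚ (tabulate (λ e → (toℕ (proj₁ (ends e)) , toℕ (proj₂ (ends e))) , rest e) ∷ []) ≡ toℕ v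
  -- Without edges the only node has number 0, the default of the program.
  eval-centre {zero} ends rest simple (zero , star) = zero , star , ≡.refl
  eval-centre {zero} ends rest simple (suc v , star) with () ← proj₁ (proj₂ star zero λ ())
  eval-centre {suc zero} ends rest simple (v , star) with proj₁ star zero
  ... | i , i≢v , inj₁ eq = v , star , cong (toℕ ∘ proj₁) eq
  -- The given centre is stored as the second end; the program returns the first, which is a centre
  -- as well.
  ... | i , i≢v , inj₂ eq = i , (only , every) , cong (toℕ ∘ proj₁) eq
    where
    only : ∀ e → ∃[ j ] j ≢ i × Joins ends e i j
    only zero = v , i≢v ∘ ≡.sym , inj₁ eq

    every : ∀ j → j ≢ i → ∃[ e ] Joins ends e i j
    every j j≢i with j ≟ᶠ v
    ... | yes ≡.refl = zero , inj₁ eq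
    ... | no  j≢v with proj₂ star j j≢v
    ...   | zero , inj₁ eq′ = contradiction (cong proj₁ (≡.trans (≡.sym eq) eq′)) i≢v
    ...   | zero , inj₂ eq′ = contradiction (cong proj₁ (≡.trans (≡.sym eq′) eq)) j≢i
  eval-centre {suc (suc m)} ends rest simple (v , star) = v , star , common
    where
    -- Two edges with the same ends would coincide by `simple`, so comparing the two satellites
    -- fails and only `v` can match.
    distinct : ∀ i j → Joins ends zero v i → Joins ends (suc zero) v j → i ≢ j
    distinct i .i J K ≡.refl with () ← simple J K

    common : eval F centreₚ (tabulate (λ e →
      (toℕ (proj₁ (ends e)) , toℕ (proj₂ (ends e))) , rest e) ∷ []) ≡ toℕ v
    common with proj₁ star zero | proj₁ star (suc zero)
    ... | i , i≢v , inj₁ p | j , j≢v , inj₁ q rewrite p | q | eqᵇ-refl (toℕ v) = ≡.refl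
    ... | i , i≢v , inj₁ p | j , j≢v , inj₂ q rewrite p | q | eqᵇ-refl (toℕ v) | eqᵇ-≢ (j≢v ∘ ≡.sym) = ≡.refl
    ... | i , i≢v , inj₂ p | j , j≢v , inj₁ q
          rewrite p | q | eqᵇ-≢ i≢v | eqᵇ-≢ (distinct i j (inj₂ p) (inj₁ q)) = ≡.refl
    ... | i , i≢v , inj₂ p | j , j≢v , inj₂ q
          rewrite p | q | eqᵇ-≢ i≢v | eqᵇ-≢ (distinct i j (inj₂ p) (inj₂ q)) = ≡.refl

-- Items and selection

foldl-enumerate : ∀ {A B : Set} {m} (g : ℕ → A → B) (f : Fin m → A) k bs →
  proj₂ (foldl (λ s a → suc (proj₁ s) , g (proj₁ s) a ∷ proj₂ s) (k , bs) (tabulate f)) ≡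
  tabulate (λ i → g (k ℕ.+ toℕ i) (f i)) ʳ++ bs
foldl-enumerate {m = zero}  g f k bs = ≡.refl
foldl-enumerate {m = suc m} g f k bs = begin
  _ ≡⟨ foldl-enumerate g (f ∘ suc) (suc k) (g k (f zero) ∷ bs) ⟩
  tabulate (λ i → g (suc k ℕ.+ toℕ i) (f (suc i))) ʳ++ (g k (f zero) ∷ bs)
    ≡⟨ cong₂ (λ is b → is ʳ++ (b ∷ bs))
         (Listₚ.tabulate-cong (λ i → cong (λ l → g l (f (suc i))) (≡.sym (ℕₚ.+-suc k (toℕ i)))))
         (cong (λ l → g l (f zero)) (≡.sym (ℕₚ.+-identityʳ k))) ⟩
  tabulate (λ i → g (k ℕ.+ toℕ i) (f i)) ʳ++ bs ∎
  where open ≡.≡-Reasoning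

module _ (F : OrderedField) where

  iterate-pred : ∀ (ρ : Env F (nat ⊗ nat ∷ [])) a b →
    iterate (λ k → eval F (caseNat #0 zero′ #0) (k ∷ ρ)) a b ≡ a ∸ b
  iterate-pred ρ a       zero    = ≡.refl
  iterate-pred ρ zero    (suc b) = ≡.trans (iterate-pred ρ zero b) (ℕₚ.0∸n≡0 b)
  iterate-pred ρ (suc a) (suc b) = iterate-pred ρ a b

  eval-minus : ∀ a b → eval F minusₚ ((a , b) ∷ []) ≡ a ∸ b
  eval-minus a b = iterate-pred ((a , b) ∷ []) a b

module Select {F : OrderedField} (I : Instance F) {v₀ : Fin (Instance.n I)}
              (star : IsStarWithCentre I v₀) where
  open OrderedField F
  open Instance I
  open Star I star

  need : Fin m → Carrier
  need e = if ⌊ ℓ e ≤? R ⌋ then 0# else (ℓ e - R)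

  key : Fin m → Carrier
  key e = if ⌊ need e ≤? u e ⌋ then (c e * need e) else (B + 1#)

  item : Fin m → Val F Item
  item e = key e , toℕ e , toℕ (satellite e) , need e

  parameters : Val F (nat ⊗ num ⊗ num)
  parameters = toℕ v₀ , R , B

  eval-item : ∀ e → eval F itemₚ ((parameters , toℕ e , encodeEdge I e) ∷ []) ≡ item e
  eval-item e with joins e
  ... | inj₁ eq rewrite eq | eqᵇ-refl (toℕ v₀) = ≡.refl
  ... | inj₂ eq rewrite eq | eqᵇ-≢ (satellite≢v₀ e) = ≡.refl

  eval-items : eval F itemsₚ ((parameters , tabulate (encodeEdge I)) ∷ []) ↭ map item (allFin m)
  eval-items = ↭-trans
    (↭-trans (↭-reflexive (foldl-enumerate (λ k x → eval F itemₚ ((parameters , k , x) ∷ [])) (encodeEdge I) 0 []))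
             (Perm.↭-reverse _))
    (↭-reflexive (≡.trans (Listₚ.tabulate-cong eval-item) (≡.sym (Listₚ.map-tabulate (λ e → e) item))))

  0≤need : ∀ e → 0# ≤ need e
  0≤need e with ℓ e ≤? R
  ... | yes _   = ≤-refl
  ... | no  ℓ≰R with total (ℓ e) R
  ...   | inj₁ ℓ≤R = contradiction ℓ≤R ℓ≰R
  ...   | inj₂ R≤ℓ = x≤y⇒0≤y-x F R≤ℓ

  ℓ-need≤R : ∀ e → ℓ e - need e ≤ R
  ℓ-need≤R e with ℓ e ≤? R
  ... | yes ℓ≤R = ≤-trans (≤-reflexive (x-0≈x F (ℓ e))) ℓ≤R
  ... | no  _   = x≤y+z⇒x-y≤z F (≤-reflexive (sym (x-y+y≈x F (ℓ e) R)))

  need-least : ∀ e {d} → 0# ≤ d → ℓ e - d ≤ R → need e ≤ d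
  need-least e 0≤d p with ℓ e ≤? R
  ... | yes _ = 0≤d
  ... | no  _ = x≤y+z⇒x-y≤z F (x-y≤z⇒x≤z+y F p)

  0≤key : ∀ e → 0# ≤ key e
  0≤key e with need e ≤? u e
  ... | yes _ = *-nonNegative (0≤c e) (0≤need e)
  ... | no  _ = +-nonNegative F 0≤B (0≤1 F)

  -- A reduction that brings the satellite within the radius is at least `need e`; being at most
  -- `u e`, it also rules out the key `B + 1#`.
  key-least : ∀ e {d} → 0# ≤ d → d ≤ u e → ℓ e - d ≤ R → key e ≤ c e * d
  key-least e 0≤d d≤u p with need e ≤? u e
  ... | yes _ = *-monoʳ-≤ F (0≤c e) (need-least e 0≤d p)
  ... | no  q = contradiction (≤-trans (need-least e 0≤d p) d≤u) q

  -- What has been spent before is non-negative, so a key that still fits the budget cannot be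
  -- `B + 1#`.
  key-affordable : ∀ e {s} → 0# ≤ s → s + key e ≤ B → need e ≤ u e × key e ≡ c e * need e
  key-affordable e {s} 0≤s p with need e ≤? u e
  ... | yes q = q , ≡.refl
  ... | no  _ = contradiction (≤-trans (y≤x+y F (B + 1#) 0≤s) p) (x+1≰x F B)

  decide : Val F SelectState → Val F Item → Val F SelectState
  decide s x = eval F selectₚ ((B , x , s) ∷ [])

  raised kept : Fin m → Val F (nat ⊗ num)
  raised e = toℕ e , need e
  kept   e = toℕ e , 0#

  private
    node : Fin m → ℕ
    node e = toℕ (satellite e)

  -- The first k satellites of the list are upgraded if the budget allows it,
  -- the others get a facility.
  record Selection (k : ℕ) (spent : Carrier) (es : List (Fin m))
                   (old new : Val F Output) : Set where
    field
      facilities chosen skipped : List (Fin m)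
      split      : es ↭ facilities ++ chosen ++ skipped
      nodes      : proj₁ new ↭ map node facilities ++ proj₁ old
      table      : proj₂ new ↭ (map kept facilities ++ map raised chosen ++ map kept skipped) ++ proj₂ old
      count      : length facilities ≡ length es ∸ k
      possible   : All (λ e → need e ≤ u e) chosen
      affordable : spent + sumOver F (λ e → c e * need e) chosen ≤ B
      maximal    : ∀ r → r ℕ.≤ k → r ℕ.≤ length es →
                   spent + sumOver F key (take r es) ≤ B → r ℕ.≤ length chosen

  -- `maximal` compares prefixes of the list. Accepting the head moves its key from the prefix into
  -- `spent`; refusing it means that no nonempty prefix fits the budget, as keys are non-negative.
  -- Once the countdown is over, only `r = 0` remains.
  eval-select : ∀ es k {spent} old → 0# ≤ spent → spent ≤ B →
    Selection k spent es old (proj₂ (foldl decide ((k , spent) , old) (map item es)))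
  eval-select [] k {spent} old 0≤s s≤B = record
    { facilities = [] ; chosen = [] ; skipped = []
    ; split = ↭-refl ; nodes = ↭-refl ; table = ↭-refl
    ; count = ≡.sym (ℕₚ.0∸n≡0 k) ; possible = []
    ; affordable = ≤-trans (≤-reflexive (+-identityʳ spent)) s≤B
    ; maximal = λ r _ r≤0 _ → r≤0
    }
  eval-select (e ∷ es) zero (ns , ds) 0≤s s≤B = record
    { facilities = e ∷ facilities ; chosen = chosen ; skipped = skipped
    ; split = ↭-prep e split
    ; nodes = ↭-trans nodes (Perm.shift _ (map node facilities) ns)
    ; table =
      ↭-trans table (Perm.shift _ (map kept facilities ++ map raised chosen ++ map kept skipped) ds)
    ; count = cong suc count ; possible = possible ; affordable = affordable
    ; maximal = λ { .zero z≤n _ _ → z≤n }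
    }
    where open Selection (eval-select es zero (node e ∷ ns , kept e ∷ ds) 0≤s s≤B)
  eval-select (e ∷ es) (suc k) {spent} (ns , ds) 0≤s s≤B with spent + key e ≤? B
  ... | yes s+key≤B = record
    { facilities = facilities ; chosen = e ∷ chosen ; skipped = skipped
    ; split = ↭-trans (↭-prep e split) (↭-sym (Perm.shift e facilities (chosen ++ skipped)))
    ; nodes = nodes
    ; table = ↭-trans table (↭-trans
        (Perm.shift _ (map kept facilities ++ map raised chosen ++ map kept skipped) ds)
        (Perm.++⁺ʳ ds (↭-sym (Perm.shift (raised e) (map kept facilities) (map raised chosen ++ map kept skipped)))))
    ; count = count ; possible = proj₁ price ∷ possible
    ; affordable =
      ≤-trans (≤-reflexive (trans (sym (+-assoc spent _ _))
          (+-congʳ (+-congˡ (reflexive (≡.sym (proj₂ price))))))) affordable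
    ; maximal = λ
        { zero    _         _         _ → z≤n
        ; (suc r) (s≤s r≤k) (s≤s r≤l) p → s≤s (maximal r r≤k r≤l (≤-trans (≤-reflexive (+-assoc spent _ _)) p))
        }
    }
    where
    price = key-affordable e 0≤s s+key≤B
    open Selection (eval-select es k {spent + key e} (ns , raised e ∷ ds) (+-nonNegative F 0≤s (0≤key e)) s+key≤B)
  ... | no s+key≰B = record
    { facilities = facilities ; chosen = chosen ; skipped = e ∷ skipped
    ; split = ↭-trans (↭-prep e split) (↭-sym (↭-trans
        (Perm.++⁺ˡ facilities (Perm.shift e chosen skipped))
        (Perm.shift e facilities (chosen ++ skipped))))
    ; nodes = nodes
    ; table = ↭-trans table (↭-trans
        (Perm.shift _ (map kept facilities ++ map raised chosen ++ map kept skipped) ds)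
        (Perm.++⁺ʳ ds (↭-sym (↭-trans
          (Perm.++⁺ˡ (map kept facilities) (Perm.shift (kept e) (map raised chosen) (map kept skipped)))
          (Perm.shift (kept e) (map kept facilities) (map raised chosen ++ map kept skipped))))))
    ; count = count ; possible = possible ; affordable = affordable
    ; maximal = λ
        { zero    _ _ _ → z≤n
        ; (suc r) _ _ p → contradiction
            (≤-trans (+-mono-≤ F ≤-refl (x≤x+y F (key e) (sumOver-nonNegative F 0≤key (take r es)))) p)
            s+key≰B
        }
    }
    where open Selection (eval-select es k (ns , kept e ∷ ds) 0≤s s≤B)

-- Running time

module _ (F : OrderedField) where

  cost-prepare : ∀ n p R B ws es → let input = n , p , R , B , ws , es in
    cost F prepareₚ (input ∷ []) ℕ.≤ size prepareₚ ℕ.* suc (length es)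
  cost-prepare n p R B ws es = cost≤ F (length es) prepareₚ ((n , p , R , B , ws , es) ∷ [])
    ((((_ , loopFree⇒loops≤ F (length es) centreₚ _ (es ∷ [])) , _) , _) , (_ , _ , _ , ℕₚ.≤-refl))

  -- Both loops stay within `p + length xs`: the subtraction has `p` rounds, the selection one round
  -- for each item. The split on `p` decides which branch of the last `caseNat` is run.
  cost-output : ∀ n p R B ws es xs → let input = n , p , R , B , ws , es in
    cost F outputₚ ((input , xs) ∷ []) ℕ.≤ size outputₚ ℕ.* suc (p ℕ.+ length xs)
  cost-output n zero R B ws es xs =
    cost≤ F (length xs) outputₚ (((n , zero , R , B , ws , es) , xs) ∷ [])
    ((_ , (((_ , (_ , _ , _ , z≤n)) , _) , _) , _ , ℕₚ.≤-refl) , _)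
  cost-output n (suc p) R B ws es xs =
    cost≤ F (suc p ℕ.+ length xs) outputₚ (((n , suc p , R , B , ws , es) , xs) ∷ [])
    ((_ , (((_ , (_ , _ , _ , ℕₚ.m≤m+n (suc p) (length xs))) , _) , _) , _ , ℕₚ.m≤n+m (length xs) (suc p)) ,
     _ , ((_ , loopFree⇒loops≤ F (suc p ℕ.+ length xs) centreₚ _ (es ∷ [])) , _) , _)

-- Lists without repetitions and the shape of the output

Unique-++⁻ˡ : ∀ {A : Set} (xs : List A) {ys} → Unique (xs ++ ys) → Unique xs
Unique-++⁻ˡ []       _         = []
Unique-++⁻ˡ (x ∷ xs) (x∉ ∷ u) = Allₚ.++⁻ˡ xs x∉ ∷ Unique-++⁻ˡ xs u

Unique-++⁻ʳ : ∀ {A : Set} (xs : List A) {ys} → Unique (xs ++ ys) → Unique ys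
Unique-++⁻ʳ []       u        = u
Unique-++⁻ʳ (x ∷ xs) (_ ∷ u) = Unique-++⁻ʳ xs u

Unique-++⇒disjoint : ∀ {A : Set} (xs : List A) {ys x} → Unique (xs ++ ys) → x List.∈ xs →
  ¬ x List.∈ ys
Unique-++⇒disjoint (x ∷ xs) (x∉ ∷ _) (here ≡.refl) x∈ys = Allₚ.All¬⇒¬Any (Allₚ.++⁻ʳ xs x∉) x∈ys
Unique-++⇒disjoint (x ∷ xs) (_ ∷ u)  (there x∈xs)  x∈ys = Unique-++⇒disjoint xs u x∈xs x∈ys

Unique-resp-↭ : ∀ {A : Set} {xs ys : List A} → xs ↭ ys → Unique xs → Unique ys
Unique-resp-↭ {A} p = Permₛ.Unique-resp-↭ (≡.setoid A) (↭⇒↭ₛ p)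

-- Two lists without repetitions and with the same members are permutations of each other; this
-- relates the program's order of the facilities to the one in `Represents`.
fromList-elements : ∀ {n} {is : List (Fin n)} → Unique is →
  is ↭ filter (_∈? fromList is) (allFin n)
fromList-elements {n} {is} u = ∼bag⇒↭ (unique∧set⇒bag u
  (Uniqueₚ.filter⁺ (_∈? fromList is) (Uniqueₚ.allFin⁺ n))
  (mk⇔ (λ i∈ → Memₚ.∈-filter⁺ (_∈? fromList is) (Memₚ.∈-allFin _) (∈-fromList⁺ is i∈))
       (λ i∈ → ∈-fromList⁻ is (proj₂ (Memₚ.∈-filter⁻ (_∈? fromList is) {xs = allFin n} i∈)))))

assemble : ∀ {A : Set} → ℕ → ℕ → List ℕ × A → List ℕ × A
assemble zero    v (ns , ds) = [] , ds
assemble (suc _) v (ns , ds) = v ∷ ns , ds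

module _ (F : OrderedField) where
  open OrderedField F using (Carrier; 0#)

  eval-output : ∀ n p R B ws es xs →
    eval F outputₚ (((n , p , R , B , ws , es) , xs) ∷ []) ≡
    assemble p (eval F centreₚ (es ∷ []))
      (proj₂ (foldl (λ s x → eval F selectₚ ((B , x , s) ∷ [])) ((n ∸ p , 0#) , [] , []) xs))
  eval-output n zero    R B ws es xs = ≡.refl
  eval-output n (suc p) R B ws es xs =
    cong (λ k → assemble (suc p) (eval F centreₚ (es ∷ []))
      (proj₂ (foldl (λ s x → eval F selectₚ ((B , x , s) ∷ [])) ((k , 0#) , [] , []) xs)))
      (eval-minus F n (suc p))

-- Feasibility and optimality of the greedy selection

module Solution {F : OrderedField} (I : Instance F) {v₀ : Fin (Instance.n I)}
                (star : IsStarWithCentre I v₀) where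
  open OrderedField F
  open Instance I
  open Star I star
  open Select I star

  nodes-unique : ∀ {es} → allFin m ↭ es → Unique (v₀ ∷ map satellite es)
  nodes-unique {es} p = All.tabulate (λ i∈ v₀≡i → fresh i∈ v₀≡i) ∷
    Uniqueₚ.map⁺ satellite-injective (Unique-resp-↭ p (Uniqueₚ.allFin⁺ m))
    where
    fresh : ∀ {i} → i List.∈ map satellite es → v₀ ≢ i
    fresh i∈ ≡.refl with Memₚ.∈-map⁻ satellite i∈
    ... | e , _ , eq = satellite≢v₀ e (≡.sym eq)

  -- The centre and the satellites of the edges list every node exactly once.
  n≡1+m : n ≡ suc m
  n≡1+m = begin
    n                                            ≡⟨ Subsetₚ.∣⊤∣≡n n ⟨
    ∣ full {n} ∣
      ≡⟨ cong ∣_∣ (Subsetₚ.⊆-antisym (λ {i} _ → all i) Subsetₚ.⊆⊤) ⟩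
    ∣ fromList (v₀ ∷ map satellite (allFin m)) ∣ ≡⟨ ∣fromList∣≡length (nodes-unique ↭-refl) ⟩
    suc (length (map satellite (allFin m)))
      ≡⟨ cong suc (Listₚ.length-map satellite (allFin m)) ⟩
    suc (length (allFin m))
      ≡⟨ cong suc (Listₚ.length-tabulate {n = m} id) ⟩
    suc m                                        ∎
    where
    open ≡.≡-Reasoning
    all : ∀ i → i ∈ fromList (v₀ ∷ map satellite (allFin m))
    all i with i ≟ᶠ v₀
    ... | yes i≡v₀ = ∈-fromList⁺ (v₀ ∷ map satellite (allFin m)) (here i≡v₀)
    ... | no  i≢v₀ with satellite-surjective i≢v₀
    ...   | e , ≡.refl =
      ∈-fromList⁺ (v₀ ∷ map satellite (allFin m)) (there (Memₚ.∈-map⁺ satellite (Memₚ.∈-allFin e)))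

  -- Separates optimality from the machine: `es` is any arrangement of the edges by increasing key,
  -- and `out` any output that meets `Selection`.
  module Greedy {es : List (Fin m)} (es-all : allFin m ↭ es)
                (es-sorted : Linked (λ e f → key e ≤ key f) es) {out : Val F Output}
                (selection : Selection (n ∸ p) 0# es ([] , []) out) where
    open Selection selection
    open DecMembership {A = Fin m} _≟ᶠ_ using () renaming (_∈?_ to _∈ˡ?_)

    ∈-es : ∀ e → e List.∈ es
    ∈-es e = Perm.∈-resp-↭ es-all (Memₚ.∈-allFin e)

    length-es : length es ≡ m
    length-es = ≡.trans (Perm.↭-length (↭-sym es-all)) (Listₚ.length-tabulate {n = m} id)

    split-unique : Unique (facilities ++ chosen ++ skipped)
    split-unique = Unique-resp-↭ (↭-trans es-all split) (Uniqueₚ.allFin⁺ m)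

    δ : Fin m → Carrier
    δ e = if ⌊ e ∈ˡ? chosen ⌋ then need e else 0#

    δ-chosen : ∀ {e} → e List.∈ chosen → δ e ≡ need e
    δ-chosen {e} e∈ with e ∈ˡ? chosen
    ... | yes _  = ≡.refl
    ... | no  e∉ = contradiction e∈ e∉

    δ-kept : ∀ {e} → ¬ e List.∈ chosen → δ e ≡ 0#
    δ-kept {e} e∉ with e ∈ˡ? chosen
    ... | yes e∈ = contradiction e∈ e∉
    ... | no  _  = ≡.refl

    δ-facilities : All (λ e → δ e ≡ 0#) facilities
    δ-facilities = All.tabulate λ e∈ → δ-kept λ e∈c →
      Unique-++⇒disjoint facilities split-unique e∈ (Memₚ.∈-++⁺ˡ e∈c)

    δ-skipped : All (λ e → δ e ≡ 0#) skipped
    δ-skipped = All.tabulate λ e∈ → δ-kept λ e∈c →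
      Unique-++⇒disjoint chosen (Unique-++⁻ʳ facilities split-unique) e∈c e∈

    δ-bounds : ∀ e → 0# ≤ δ e × δ e ≤ u e
    δ-bounds e with e ∈ˡ? chosen
    ... | yes e∈ = 0≤need e , All.lookup possible e∈
    ... | no  _  = ≤-refl , 0≤u e

    table-δ : proj₂ out ↭ tabulate (λ e → toℕ e , δ e)
    table-δ = begin
      proj₂ out                                                            ↭⟨ table ⟩
      (map kept facilities ++ map raised chosen ++ map kept skipped) ++ []
        ≡⟨ Listₚ.++-identityʳ _ ⟩
      map kept facilities ++ map raised chosen ++ map kept skipped
        ≡⟨ cong₂ _++_ (entries δ-facilities)
             (cong₂ _++_ (entries (All.tabulate δ-chosen)) (entries δ-skipped)) ⟩
      map entry facilities ++ map entry chosen ++ map entry skipped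
        ≡⟨ cong (map entry facilities ++_) (Listₚ.map-++ entry chosen skipped) ⟨
      map entry facilities ++ map entry (chosen ++ skipped)
        ≡⟨ Listₚ.map-++ entry facilities (chosen ++ skipped) ⟨
      map entry (facilities ++ chosen ++ skipped)
        ↭⟨ Perm.map⁺ entry (↭-trans es-all split) ⟨
      map entry (allFin m)
        ≡⟨ Listₚ.map-tabulate id entry ⟩
      tabulate entry                                                       ∎
      where
      open PermutationReasoning
      entry : Fin m → Val F (nat ⊗ num)
      entry e = toℕ e , δ e

      entries : ∀ {f : Fin m → Carrier} {fs} → All (λ e → δ e ≡ f e) fs →
        map (λ e → toℕ e , f e) fs ≡ map entry fs
      entries []         = ≡.refl
      entries (eq ∷ eqs) = cong₂ _∷_ (cong (_ ,_) (≡.sym eq)) (entries eqs)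

    upgradeCost : (Fin m → Carrier) → Fin m → Carrier
    upgradeCost δ e = c e * δ e

    sum≈sumOver : ∀ f → sum f ≈ sumOver F f es
    sum≈sumOver f = trans (reflexive (≡.sym (sumOver-tabulate F f id))) (sumOver-↭ F f es-all)

    within-budget : sum (upgradeCost δ) ≤ B
    within-budget = begin
      sum (upgradeCost δ)                                             ≈⟨ sum≈sumOver _ ⟩
      sumOver F (upgradeCost δ) es                                    ≈⟨ sumOver-↭ F _ split ⟩
      sumOver F (upgradeCost δ) (facilities ++ chosen ++ skipped)
        ≈⟨ sumOver-++ F _ facilities _ ⟩
      sumOver F (upgradeCost δ) facilities + sumOver F (upgradeCost δ) (chosen ++ skipped)
        ≈⟨ +-cong (sumOver-zero F (All.map free δ-facilities)) (sumOver-++ F _ chosen skipped) ⟩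
      0# + (sumOver F (upgradeCost δ) chosen + sumOver F (upgradeCost δ) skipped)
        ≈⟨ +-congˡ (+-cong (sumOver-cong F (All.tabulate λ e∈ → *-congˡ (reflexive (δ-chosen e∈))))
                           (sumOver-zero F (All.map free δ-skipped))) ⟩
      0# + (sumOver F (upgradeCost need) chosen + 0#)
        ≈⟨ +-congˡ (+-identityʳ _) ⟩
      0# + sumOver F (upgradeCost need) chosen                        ≤⟨ affordable ⟩
      B                                                               ∎
      where
      open PartialOrderReasoning (poset F)
      free : ∀ {e} → δ e ≡ 0# → upgradeCost δ e ≈ 0#
      free {e} eq = trans (*-congˡ (reflexive eq)) (zeroʳ (c e))

    -- The number of facilities is an argument to allow the case distinction that `p`, a field of
    -- the instance, does not; the function is used at `p`.
    facilityNodes : ℕ → List (Fin n)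
    facilityNodes zero    = []
    facilityNodes (suc _) = v₀ ∷ map satellite facilities

    nodes-assemble : ∀ k → proj₁ (assemble k (toℕ v₀) out) ↭ map toℕ (facilityNodes k)
    nodes-assemble zero    = ↭-refl
    nodes-assemble (suc _) = ↭-prep (toℕ v₀) (↭-trans nodes (↭-reflexive
      (≡.trans (Listₚ.++-identityʳ _) (Listₚ.map-∘ facilities))))

    covered-unique : Unique (v₀ ∷ map satellite (facilities ++ chosen))
    covered-unique =
      Unique-++⁻ˡ (v₀ ∷ map satellite (facilities ++ chosen)) {map satellite skipped}
      (subst (λ is → Unique (v₀ ∷ is))
        (≡.trans (cong (map satellite) (≡.sym (Listₚ.++-assoc facilities chosen skipped)))
                 (Listₚ.map-++ satellite (facilities ++ chosen) skipped))
        (nodes-unique (↭-trans es-all split)))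

    facilityNodes-unique : ∀ k → Unique (facilityNodes k)
    facilityNodes-unique zero    = []
    facilityNodes-unique (suc _) =
      Unique-++⁻ˡ (v₀ ∷ map satellite facilities) {map satellite chosen}
      (subst (λ is → Unique (v₀ ∷ is)) (Listₚ.map-++ satellite facilities chosen) covered-unique)

    facilityNodes-length : ∀ k → k ℕ.≤ n → length facilities ≡ length es ∸ (n ∸ k) →
                           length (facilityNodes k) ≡ k
    facilityNodes-length zero    _   _  = ≡.refl
    facilityNodes-length (suc k) k≤n eq = cong suc (begin
      length (map satellite facilities) ≡⟨ Listₚ.length-map satellite facilities ⟩
      length facilities                 ≡⟨ eq ⟩
      length es ∸ (n ∸ suc k)           ≡⟨ cong₂ (λ a b → a ∸ (b ∸ suc k)) length-es n≡1+m ⟩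
      m ∸ (m ∸ k)
        ≡⟨ ℕₚ.m∸[m∸n]≡n (ℕₚ.≤-pred (subst (suc k ℕ.≤_) n≡1+m k≤n)) ⟩
      k                                 ∎)
      where open ≡.≡-Reasoning

    X : Subset n
    X = fromList (facilityNodes p)

    ∣X∣≡p : ∣ X ∣ ≡ p
    ∣X∣≡p =
      ≡.trans (∣fromList∣≡length (facilityNodes-unique p)) (facilityNodes-length p p≤n count)

    feasible : Feasible I X δ
    feasible = ∣X∣≡p , δ-bounds , within-budget

    represents : ∀ {o} → o ≡ assemble p (toℕ v₀) out → Represents I o X δ
    represents ≡.refl =
      ↭-trans (nodes-assemble p) (Perm.map⁺ toℕ (fromList-elements (facilityNodes-unique p))) ,
      ↭-trans (↭-reflexive (table-assemble p)) table-δ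
      where
      table-assemble : ∀ k → proj₂ (assemble k (toℕ v₀) out) ≡ proj₂ out
      table-assemble zero    = ≡.refl
      table-assemble (suc _) = ≡.refl

    totalWeight-mono : UniformWeights I → ∀ C C′ → ∣ C ∣ ℕ.≤ ∣ C′ ∣ →
      totalWeight I C ≤ totalWeight I C′
    totalWeight-mono (w₀ , 0≤w₀ , w≈w₀) C C′ p = begin
      totalWeight I C  ≈⟨ sum-indicator F w≈w₀ C ⟩
      _                ≤⟨ ·-monoˡ-≤ F 0≤w₀ p ⟩
      _                ≈⟨ sum-indicator F w≈w₀ C′ ⟨
      totalWeight I C′ ∎
      where open PartialOrderReasoning (poset F)

    -- C lies within X and the nodes near the centre, and within X alone
    -- unless the two meet.  So the r nodes near the centre outside X are at
    -- most as many as the satellites near the centre, and at most n − p.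
    coverage-bound : ∀ X δ C → Feasible I X δ → IsCoveredSet I X δ C →
                     ∣ C ∣ ℕ.≤ p ℕ.+ length chosen
    coverage-bound X δ C (∣X∣≡p , bounds , budget) C-covered
      with Finₚ.any? (λ i → (i ∈? C) ×-dec ¬? (i ∈? X))
    ... | no C⊆X = begin
      ∣ C ∣
        ≤⟨ Subsetₚ.p⊆q⇒∣p∣≤∣q∣ (λ {i} i∈C → decidable-stable (i ∈? X) (λ i∉X → C⊆X (i , i∈C , i∉X))) ⟩
      ∣ X ∣               ≡⟨ ∣X∣≡p ⟩
      p                   ≤⟨ ℕₚ.m≤m+n p _ ⟩
      p ℕ.+ length chosen ∎
      where open ℕₚ.≤-Reasoning
    ... | yes (i , i∈C , i∉X) = begin
      ∣ C ∣               ≤⟨ Subsetₚ.p⊆q⇒∣p∣≤∣q∣ C⊆X∪G ⟩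
      ∣ X ∪ G ∣           ≡⟨ ∣p∪q∣≡∣p∣+∣q─p∣ X G ⟩
      ∣ X ∣ ℕ.+ r         ≡⟨ cong (ℕ._+ r) ∣X∣≡p ⟩
      p ℕ.+ r
        ≤⟨ ℕₚ.+-monoʳ-≤ p (maximal r r≤n∸p
             (ℕₚ.≤-trans r≤near (Listₚ.length-filter (near? δ bounds) es)) affordable-r) ⟩
      p ℕ.+ length chosen ∎
      where
      open ℕₚ.≤-Reasoning
      G = nearCentre δ bounds es
      r = ∣ G ─ X ∣

      C⊆X∪G : C ⊆ X ∪ G
      C⊆X∪G {k} k∈C = Subsetₚ.x∈p∪q⁺ (Sum.map₂ (nearCentre⁺ δ bounds es ∈-es)
        (covered⇒nearCentre δ bounds (Equivalence.to (C-covered k) k∈C)))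

      meet : Nonempty (G ∩ X)
      meet with covered⇒nearFacility δ bounds (Equivalence.to (C-covered i) i∈C) i∉X
      ... | j , j∈X , near = j , Subsetₚ.x∈p∩q⁺ (nearCentre⁺ δ bounds es ∈-es near , j∈X)

      r≤near : r ℕ.≤ length (filter (near? δ bounds) es)
      -- The facility from `meet` lies in `G` but not in `G ─ X`. This one node makes up for the
      -- centre, which `G` contains besides the near satellites.
      r≤near = ℕₚ.≤-pred (begin
        suc r
          ≤⟨ Subsetₚ.p∩q≢∅⇒∣p─q∣<∣p∣ G X meet ⟩
        ∣ G ∣
          ≤⟨ ∣fromList∣≤length (v₀ ∷ map satellite (filter (near? δ bounds) es)) ⟩
        suc (length (map satellite (filter (near? δ bounds) es)))
          ≡⟨ cong suc (Listₚ.length-map satellite (filter (near? δ bounds) es)) ⟩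
        suc (length (filter (near? δ bounds) es))                   ∎)

      r≤n∸p : r ℕ.≤ n ∸ p
      -- `X ∪ G` has `p + r` nodes, and there are only `n`.
      r≤n∸p = begin
        r                 ≡⟨ ℕₚ.m+n∸m≡n p r ⟨
        p ℕ.+ r ∸ p       ≡⟨ cong (λ k → k ℕ.+ r ∸ p) ∣X∣≡p ⟨
        ∣ X ∣ ℕ.+ r ∸ p   ≡⟨ cong (_∸ p) (∣p∪q∣≡∣p∣+∣q─p∣ X G) ⟨
        ∣ X ∪ G ∣ ∸ p     ≤⟨ ℕₚ.∸-monoˡ-≤ p (Subsetₚ.∣p∣≤n (X ∪ G)) ⟩
        n ∸ p             ∎

      affordable-r : 0# + sumOver F key (take r es) ≤ B
      -- The rival pays at least the key for each near satellite, and there are `r` of them or more,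
      -- so its budget covers the `r` smallest keys.
      affordable-r = ≤-trans (≤-reflexive (+-identityˡ _)) (≤-trans
        (sum-take-least F key (near? δ bounds)
          (λ e → *-nonNegative (0≤c e) (proj₁ (bounds e)))
          (λ e → key-least e (proj₁ (bounds e)) (proj₂ (bounds e)))
          r es-sorted r≤near)
        (≤-trans (≤-reflexive (sym (sum≈sumOver (upgradeCost δ)))) budget))

    no-facilities : ∀ {X δ i} → p ≡ 0 → ∣ X ∣ ≡ p → ¬ Covered I X δ i
    no-facilities p≡0 ∣X∣≡p (j , j∈X , _) =
      contradiction (≡.trans ∣X∣≡p p≡0) (ℕₚ.m<n⇒n≢0 (Subsetₚ.x∈p⇒∣p-x∣<∣p∣ j∈X))

    near-chosen : ∀ {e} → e List.∈ chosen → Near δ δ-bounds e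
    near-chosen {e} e∈ =
      ≤-trans (≤-reflexive (+-congˡ (-‿cong (reflexive (δ-chosen e∈))))) (ℓ-need≤R e)

    optimal : UniformWeights I → Optimal I X δ
    optimal uniform = feasible , best p ≡.refl
      where
      best : ∀ k → p ≡ k → ∃[ C ] IsCoveredSet I X δ C ×
        (∀ X′ δ′ C′ → Feasible I X′ δ′ → IsCoveredSet I X′ δ′ C′ → totalWeight I C′ ≤ totalWeight I C)
      -- Without facilities no solution covers anything, so all feasible pairs are equally good.
      best zero p≡0 = ∅ ,
        (λ i → mk⇔ (λ i∈∅ → contradiction i∈∅ Subsetₚ.∉⊥)
                   (λ covered → contradiction covered (no-facilities p≡0 ∣X∣≡p))) ,
        λ X′ δ′ C′ feasible′ C′-covered → totalWeight-mono uniform C′ ∅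
          (Subsetₚ.p⊆q⇒∣p∣≤∣q∣ {p = C′} {q = ∅} λ {i} i∈C′ →
          contradiction (Equivalence.to (C′-covered i) i∈C′) (no-facilities p≡0 (proj₁ feasible′)))
      best (suc q) p≡1+q = C ,
        (λ i → mk⇔ (λ i∈C → nearCentre⇒covered δ δ-bounds v₀∈X
                      (Sum.map₂ (nearCentre⁻ δ δ-bounds es) (Subsetₚ.x∈p∪q⁻ X _ i∈C)))
                   (λ covered → Subsetₚ.x∈p∪q⁺ (Sum.map₂ (nearCentre⁺ δ δ-bounds es ∈-es)
                      (covered⇒nearCentre δ δ-bounds covered)))) ,
        λ X′ δ′ C′ feasible′ C′-covered → totalWeight-mono uniform C′ C
          (ℕₚ.≤-trans (coverage-bound X′ δ′ C′ feasible′ C′-covered) C-large)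
        where
        C = X ∪ nearCentre δ δ-bounds es

        nodes≡ : facilityNodes p ≡ v₀ ∷ map satellite facilities
        nodes≡ = cong facilityNodes p≡1+q

        v₀∈X : v₀ ∈ X
        v₀∈X = ∈-fromList⁺ (facilityNodes p) (subst (v₀ List.∈_) (≡.sym nodes≡) (here ≡.refl))

        -- A lower bound for `C` is enough: these nodes are distinct, and their number
        -- `p + length chosen` is what `coverage-bound` allows any rival.
        covered-nodes : List (Fin n)
        covered-nodes = v₀ ∷ map satellite (facilities ++ chosen)

        ∈-C : ∀ {i} → i List.∈ covered-nodes → i ∈ C
        ∈-C (here ≡.refl) = Subsetₚ.x∈p∪q⁺ (inj₁ v₀∈X)
        ∈-C (there i∈) with Memₚ.∈-map⁻ satellite i∈
        ... | e , e∈ , ≡.refl with Memₚ.∈-++⁻ facilities e∈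
        ...   | inj₁ e∈f = Subsetₚ.x∈p∪q⁺ (inj₁ (∈-fromList⁺ (facilityNodes p)
          (subst (satellite e List.∈_) (≡.sym nodes≡) (there (Memₚ.∈-map⁺ satellite e∈f)))))
        ...   | inj₂ e∈c = Subsetₚ.x∈p∪q⁺ (inj₂ (nearCentre⁺ δ δ-bounds es ∈-es
          (inj₂ (e , ≡.refl , near-chosen e∈c))))

        C-large : p ℕ.+ length chosen ℕ.≤ ∣ C ∣
        C-large = begin
          p ℕ.+ length chosen
            ≡⟨ cong (ℕ._+ length chosen) (facilityNodes-length p p≤n count) ⟨
          length (facilityNodes p) ℕ.+ length chosen
            ≡⟨ cong (λ is → length is ℕ.+ length chosen) nodes≡ ⟩
          suc (length (map satellite facilities) ℕ.+ length chosen)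
            ≡⟨ cong (λ k → suc (k ℕ.+ length chosen)) (Listₚ.length-map satellite facilities) ⟩
          suc (length facilities ℕ.+ length chosen)
            ≡⟨ cong suc (Listₚ.length-++ facilities) ⟨
          suc (length (facilities ++ chosen))
            ≡⟨ cong suc (Listₚ.length-map satellite (facilities ++ chosen)) ⟨
          length covered-nodes                          ≡⟨ ∣fromList∣≡length covered-unique ⟨
          ∣ fromList covered-nodes ∣
            ≤⟨ Subsetₚ.p⊆q⇒∣p∣≤∣q∣ (λ i∈ → ∈-C (∈-fromList⁻ covered-nodes i∈)) ⟩
          ∣ C ∣                                         ∎
          where open ℕₚ.≤-Reasoning

-- The whole program: correctness and running time

module _ {F : OrderedField} (I : Instance F) where
  open OrderedField F
  open Instance I

  private
    prepared sorted : Val F (list Item)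
    prepared = eval F prepareₚ (encode I ∷ [])
    sorted   = eval F sortₚ (prepared ∷ [])

  prepare-↭ : ∀ {v₀} (star : IsStarWithCentre I v₀) →
    eval F centreₚ (tabulate (encodeEdge I) ∷ []) ≡ toℕ v₀ →
    prepared ↭ map (Select.item I star) (allFin m)
  prepare-↭ star centre≡ = ↭-trans
    (↭-reflexive (cong (λ v → eval F itemsₚ (((v , R , B) , tabulate (encodeEdge I)) ∷ [])) centre≡))
    (Select.eval-items I star)

  solves : IsStar I → UniformWeights I → Solves I mainₚ
  -- From here on the centre is the one that the program finds.
  solves isStar uniform with eval-centre F ends (λ e → ℓ e , u e , c e) simple isStar
  ... | v₀ , star , centre≡ = X , δ , represents output≡ , optimal uniform
    where
    open Select I star

    arrangement : ∃[ es ] sorted ≡ map item es × allFin m ↭ es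
    -- A permutation of a mapped list is again a mapped list, so the sorted items can be read as a
    -- list of edges.
    arrangement = Perm.↭-map-inv item
      (↭-sym (↭-trans (proj₁ (eval-sort F prepared)) (prepare-↭ star centre≡)))

    es = proj₁ arrangement

    es-sorted : Linked (λ e f → key e ≤ key f) es
    es-sorted =
      Linkedₚ.map⁻ (subst (Linked (λ x y → proj₁ x ≤ proj₁ y)) (proj₁ (proj₂ arrangement))
      (proj₂ (eval-sort F prepared)))

    selection = eval-select es (n ∸ p) ([] , []) ≤-refl 0≤B

    output≡ : eval F mainₚ (encode I ∷ []) ≡
      assemble p (toℕ v₀) (proj₂ (foldl decide ((n ∸ p , 0#) , [] , []) (map item es)))
    output≡ = ≡.trans (eval-output F n p R B (tabulate w) (tabulate (encodeEdge I)) sorted)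
      (cong₂ (λ v xs → assemble p v (proj₂ (foldl decide ((n ∸ p , 0#) , [] , []) xs)))
        centre≡ (proj₁ (proj₂ arrangement)))

    open Solution I star
    open Greedy (proj₂ (proj₂ arrangement)) es-sorted selection

  -- The 6 counts the constructs of `mainₚ` itself: three calls, a pair and two variables. As a star
  -- has `n = m + 1`, the `suc` in the bounds of the parts is absorbed into `n`.
  cost-main : IsStar I → runningTime I mainₚ ℕ.≤
    6 ℕ.+ (size prepareₚ ℕ.* n ℕ.+
          (linearFactor ℕ.* n ℕ.+ ⌈log₂ n ⌉ ℕ.* ((n ℕ.+ n) ℕ.* mergeFactor)) ℕ.+
          size outputₚ ℕ.* (n ℕ.+ n))
  cost-main isStar with eval-centre F ends (λ e → ℓ e , u e , c e) simple isStar
  ... | v₀ , star , centre≡ = ℕₚ.+-monoʳ-≤ 6 (ℕₚ.+-mono-≤ (ℕₚ.+-mono-≤ prepare sort) output)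
    where
    n≡1+m = Solution.n≡1+m I star
    m≤n : m ℕ.≤ n
    m≤n = ℕₚ.≤-trans (ℕₚ.n≤1+n m) (ℕₚ.≤-reflexive (≡.sym n≡1+m))

    length-edges : length (tabulate (encodeEdge I)) ≡ m
    length-edges = Listₚ.length-tabulate (encodeEdge I)

    length-items : length prepared ≡ m
    length-items = ≡.trans (Perm.↭-length (prepare-↭ star centre≡))
      (≡.trans (Listₚ.length-map (Select.item I star) (allFin m))
        (Listₚ.length-tabulate {n = m} id))

    length-sorted : length sorted ≡ m
    length-sorted = ≡.trans (Perm.↭-length (proj₁ (eval-sort F prepared))) length-items

    prepare : cost F prepareₚ (encode I ∷ []) ℕ.≤ size prepareₚ ℕ.* n
    prepare = begin
      cost F prepareₚ (encode I ∷ [])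
        ≤⟨ cost-prepare F n p R B (tabulate w) (tabulate (encodeEdge I)) ⟩
      size prepareₚ ℕ.* suc (length (tabulate (encodeEdge I)))
        ≡⟨ cong (λ k → size prepareₚ ℕ.* suc k) length-edges ⟩
      size prepareₚ ℕ.* suc m ≡⟨ cong (size prepareₚ ℕ.*_) n≡1+m ⟨
      size prepareₚ ℕ.* n ∎
      where open ℕₚ.≤-Reasoning

    sort : cost F sortₚ (prepared ∷ []) ℕ.≤ linearFactor ℕ.* n ℕ.+ ⌈log₂ n ⌉ ℕ.* ((n ℕ.+ n) ℕ.* mergeFactor)
    sort = begin
      cost F sortₚ (prepared ∷ []) ≤⟨ cost-sort F prepared ⟩
      bound (length prepared)      ≡⟨ cong bound length-items ⟩
      bound m
        ≤⟨ ℕₚ.+-mono-≤ (ℕₚ.≤-reflexive (cong (linearFactor ℕ.*_) (≡.sym n≡1+m)))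
             (ℕₚ.*-mono-≤ (⌈log₂⌉-mono-≤ m≤n) (ℕₚ.*-monoˡ-≤ mergeFactor (ℕₚ.+-mono-≤ m≤n m≤n))) ⟩
      linearFactor ℕ.* n ℕ.+ ⌈log₂ n ⌉ ℕ.* ((n ℕ.+ n) ℕ.* mergeFactor) ∎
      where
      open ℕₚ.≤-Reasoning
      bound : ℕ → ℕ
      bound k = linearFactor ℕ.* suc k ℕ.+ ⌈log₂ k ⌉ ℕ.* ((k ℕ.+ k) ℕ.* mergeFactor)

    output : cost F outputₚ ((encode I , sorted) ∷ []) ℕ.≤ size outputₚ ℕ.* (n ℕ.+ n)
    output = begin
      cost F outputₚ ((encode I , sorted) ∷ [])
        ≤⟨ cost-output F n p R B (tabulate w) (tabulate (encodeEdge I)) sorted ⟩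
      size outputₚ ℕ.* suc (p ℕ.+ length sorted)
        ≡⟨ cong (λ k → size outputₚ ℕ.* suc (p ℕ.+ k)) length-sorted ⟩
      size outputₚ ℕ.* suc (p ℕ.+ m)
        ≡⟨ cong (size outputₚ ℕ.*_) (≡.trans (≡.sym (ℕₚ.+-suc p m)) (cong (p ℕ.+_) (≡.sym n≡1+m))) ⟩
      size outputₚ ℕ.* (p ℕ.+ n)
        ≤⟨ ℕₚ.*-monoʳ-≤ (size outputₚ) (ℕₚ.+-monoˡ-≤ n p≤n) ⟩
      size outputₚ ℕ.* (n ℕ.+ n)                     ∎
      where open ℕₚ.≤-Reasoning

open import Data.Nat.Base using (_+_; _*_; _≤_)

theorem2 : Σ[ P ∈ Program ]
    ((F : OrderedField) (I : Instance F) → IsStar I → UniformWeights I →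
    Solves I P) ×
    (∃[ K ] ∃[ N ] ((F : OrderedField) (I : Instance F) →
    IsStar I → UniformWeights I → N ≤ Instance.n I →
    runningTime I P ≤ K * (Instance.n I * ⌈log₂ Instance.n I ⌉)))
theorem2 = mainₚ , (λ F I → solves I) ,
  -- The threshold is 2 because the logarithm vanishes at `n = 1`. From two nodes on it is at least
  -- 1, and the constant and linear terms are bounded by multiples of `n * ⌈log₂ n ⌉`.
  6 + (size prepareₚ + (linearFactor + 2 * mergeFactor) + size outputₚ * 2) , 2 ,
  λ F I isStar _ 2≤n → ℕₚ.≤-trans (cost-main I isStar)
    (collect (size prepareₚ) linearFactor mergeFactor (size outputₚ) (Instance.n I) 2≤n)
  where
  collect : ∀ a b s d n → 2 ≤ n →
    6 + (a * n + (b * n + ⌈log₂ n ⌉ * ((n + n) * s)) + d * (n + n)) ≤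
    (6 + (a + (b + 2 * s) + d * 2)) * (n * ⌈log₂ n ⌉)
  collect a b s d n 2≤n = begin
    6 + (a * n + (b * n + ⌈log₂ n ⌉ * ((n + n) * s)) + d * (n + n))
      ≡⟨ eq₁ a b s d n ⌈log₂ n ⌉ ⟩
    6 * 1 + (a + b + d * 2) * n + 2 * s * (n * ⌈log₂ n ⌉)
      ≤⟨ ℕₚ.+-monoˡ-≤ _ (ℕₚ.+-mono-≤ (ℕₚ.*-monoʳ-≤ 6 1≤nL) (ℕₚ.*-monoʳ-≤ (a + b + d * 2) n≤nL)) ⟩
    6 * (n * ⌈log₂ n ⌉) + (a + b + d * 2) * (n * ⌈log₂ n ⌉) + 2 * s * (n * ⌈log₂ n ⌉)
      ≡⟨ eq₂ a b s d (n * ⌈log₂ n ⌉) ⟩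
    (6 + (a + (b + 2 * s) + d * 2)) * (n * ⌈log₂ n ⌉) ∎
    where
    open ℕₚ.≤-Reasoning
    1≤L : 1 ≤ ⌈log₂ n ⌉
    1≤L = ⌈log₂⌉-mono-≤ 2≤n

    n≤nL : n ≤ n * ⌈log₂ n ⌉
    n≤nL = ℕₚ.≤-trans (ℕₚ.≤-reflexive (≡.sym (ℕₚ.*-identityʳ n))) (ℕₚ.*-monoʳ-≤ n 1≤L)

    1≤nL : 1 ≤ n * ⌈log₂ n ⌉
    1≤nL = ℕₚ.≤-trans (ℕₚ.≤-trans (ℕₚ.n≤1+n 1) 2≤n) n≤nL

    eq₁ : ∀ a b s d n L → 6 + (a * n + (b * n + L * ((n + n) * s)) + d * (n + n)) ≡
                          6 * 1 + (a + b + d * 2) * n + 2 * s * (n * L)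
    eq₁ = solve-∀

    eq₂ : ∀ a b s d N →
      6 * N + (a + b + d * 2) * N + 2 * s * N ≡ (6 + (a + (b + 2 * s) + d * 2)) * N
    eq₂ = solve-∀
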